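{- For $w\in W_n$, the following are equivalent: (1) $w$ is vexillary; (2) the essential positions $(p_i,q_i)$ of $w$ can be ordered so that $p_1\ge\cdots\ge p_s>0$ and $q_1\ge\cdots\ge q_s>0$; (3) the permutation $\iota(w)$ is vexillary as an element of $S_{2n+1}$.
   Context: Write $\bar a$ for $-a$. A signed permutation is a bijection $w$ of $\mathbb Z$ with $w(\bar i)=\overline{w(i)}$ for all $i$ and $w(i)=i$ for $|i|$ large; $W_n$ is the group of those with $w(i)=i$ for $i>n$. $\iota(w)\in S_{2n+1}$ is the permutation of $\{\bar n,\dots,n\}$ with one-line notation $\overline{w(n)}\cdots\overline{w(1)}\,0\,w(1)\cdots w(n)$. An ordinary permutation $v$ is vexillary iff there are no $a<b<c<d$ with $v(b)<v(a)<v(d)<v(c)$. A triple is $\boldsymbol\tau=(\mathbf k,\mathbf p,\mathbf q)$ of $s$-tuples of positive integers ($s\ge 0$) with $0<k_1<\cdots<k_s$, $p_1\ge\cdots\ge p_s>0$, $q_1\ge\cdots\ge q_s>0$, and $p_i-p_{i+1}+q_i-q_{i+1}\ge k_{i+1}-k_i$ for $1\le i\le s-1$. The signed permutation $w(\boldsymbol\tau)$ is built on positions $1,2,\dots,n$: for $i=1,\dots,s$ in turn (with $k_0=0$), take the $k_i-k_{i-1}$ smallest positive integers $c\ge q_i$ not yet used, and place their negatives $\bar c$ in increasing order into the first $k_i-k_{i-1}$ vacant positions that are $\ge p_i$ (left to right), marking these $c$ as used; finally fill the remaining vacant positions, left to right, with the unused positive integers in increasing order (the empty triple gives the identity). $w$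 is vexillary if $w=w(\boldsymbol\tau)$ for some triple. Diagrams: for $v$ a permutation of $\{\bar n,\dots,n\}$, $D(v)=\{(a,b): v(b)>a \text{ and } v^{ -1}(a)>b\}$ (box in row $a$, column $b$). The extended diagram of $w\in W_n$ is $\tilde D_w=\{(a,b)\in D(\iota(w)): b\le -1\}$; a SE corner of $\tilde D_w$ is a box $(a,b)\in\tilde D_w$ with $(a+1,b)\notin\tilde D_w$ and $(a,b+1)\notin\tilde D_w$. Rank function: $r_w(p,q)=\#\{i:\bar n\le i\le\bar p,\ w(i)\ge q\}$. The essential set $\mathscr{E}ss(w)$ is the set of $(k,p,q)$ with $(q-1,\bar p)$ a SE corner of $\tilde D_w$ and $k=r_w(p,q)$, except: if $p=1$ and $q<0$ then $(k,p,q)\notin\mathscr{E}ss(w)$; and if $p>1$, $q>0$, there is another SE corner in box $(\bar q,\bar p)$, and $k=r_w(p,q)=r_w(p,\bar q+1)-q+1$, then $(k,p,q)\notin\mathscr{E}ss(w)$. The essential positions are the pairs $(p,q)$ with $(k,p,q)\in\mathscr{E}ss(w)$ for some $k$. -}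

module Defs where

open import Data.Nat as ℕ using (ℕ; zero; suc)
open import Data.Integer as ℤ using (ℤ; +_; -[1+_]; ∣_∣)
open import Data.Bool using (Bool; true; false)
open import Data.Maybe as Maybe using (Maybe; just; nothing; _>>=_; fromMaybe)
open import Data.List using (List; []; _∷_; _++_; map; filter; take; reverse; length; replicate)
open import Data.List.Membership.DecPropositional ℕ._≟_ using (_∈?_)
open import Data.List.Relation.Binary.Permutation.Propositional using (_↭_)
open import Data.List.Relation.Unary.All using (All)
open import Data.List.Relation.Unary.Linked using (Linked)
open import Data.Vec using (Vec; toList)
open import Data.Product using (Σ; ∃; _×_; _,_)
open import Relation.Nullary using (¬_; ¬?; yes; no)
open import Relation.Binary.PropositionalEquality using (_≡_)

rangeFrom : ℕ → ℕ → List ℕ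
rangeFrom a zero    = []
rangeFrom a (suc m) = a ∷ rangeFrom (suc a) m

at : List ℤ → ℕ → Maybe ℤ
at []       _       = nothing
at (x ∷ xs) zero    = just x
at (x ∷ xs) (suc i) = at xs i

-- Signed permutations in W_n.
-- An element of W_n is given by its values w(1), ..., w(n); the absolute
-- values must be a permutation of 1, ..., n.  It is extended to a
-- bijection of ℤ by w(0) = 0, w(-i) = -w(i) and w(i) = i for i > n.

record SignedPerm (n : ℕ) : Set where
  constructor mkSP
  field
    img    : Vec ℤ n
    isPerm : map ∣_∣ (toList img) ↭ rangeFrom 1 n
open SignedPerm public

app : ∀ {n} → SignedPerm n → ℤ → ℤ
app w (+ zero)   = + zero
app w (+ suc i)  = fromMaybe (+ suc i) (at (toList (img w)) i)
app w -[1+ i ]   = ℤ.- fromMaybe (+ suc i) (at (toList (img w)) i)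

-- A triple (k, p, q) of s-tuples is represented as the list of the
-- s columns (k_i , p_i , q_i).
Triple : Set
Triple = List (ℕ × ℕ × ℕ)

TripleStep : (ℕ × ℕ × ℕ) → (ℕ × ℕ × ℕ) → Set
TripleStep (k , p , q) (k' , p' , q') =
  (k ℕ.< k') × (p' ℕ.≤ p) × (q' ℕ.≤ q) × (k' ℕ.∸ k ℕ.≤ (p ℕ.∸ p') ℕ.+ (q ℕ.∸ q'))

PositiveCol : (ℕ × ℕ × ℕ) → Set
PositiveCol (k , p , q) = (0 ℕ.< k) × (0 ℕ.< p) × (0 ℕ.< q)

IsTriple : Triple → Set
IsTriple τ = All PositiveCol τ × Linked TripleStep τ

-- the m smallest positive integers c ≥ q not in `used`, increasing
-- (the interval [q, q + m + |used|) contains at least m such c)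
smallestUnused : ℕ → ℕ → List ℕ → List ℕ
smallestUnused m q used =
  take m (filter (λ c → ¬? (c ∈? used)) (rangeFrom q (m ℕ.+ length used)))

-- place the given values, in order, into the first vacant positions ≥ p
-- (positions are numbered from the first argument on); fails if there
-- are not enough vacant positions
place : ℕ → ℕ → List ℤ → List (Maybe ℤ) → Maybe (List (Maybe ℤ))
place i p []       ss             = just ss
place i p (x ∷ xs) []             = nothing
place i p (x ∷ xs) (just y ∷ ss)  = Maybe.map (just y ∷_) (place (suc i) p (x ∷ xs) ss)
place i p (x ∷ xs) (nothing ∷ ss) with p ℕ.≤? i
... | yes _ = Maybe.map (just x ∷_)  (place (suc i) p xs ss)
... | no  _ = Maybe.map (nothing ∷_) (place (suc i) p (x ∷ xs) ss)

-- process the columns of the triple (first argument: k_{i-1})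
blocks : ℕ → Triple → List (Maybe ℤ) → List ℕ → Maybe (List (Maybe ℤ) × List ℕ)
blocks kp []                  ss used = just (ss , used)
blocks kp ((k , p , q) ∷ τ)   ss used =
  let vals = smallestUnused (k ℕ.∸ kp) q used in
  place 1 p (reverse (map (λ c → ℤ.- (+ c)) vals)) ss >>= λ ss' →
  blocks k τ ss' (used ++ vals)

fill : List ℕ → List (Maybe ℤ) → Maybe (List ℤ)
fill us       []             = just []
fill us       (just y ∷ ss)  = Maybe.map (y ∷_) (fill us ss)
fill []       (nothing ∷ ss) = nothing
fill (u ∷ us) (nothing ∷ ss) = Maybe.map (+ u ∷_) (fill us ss)

-- the one-line notation w(τ)(1) ... w(τ)(N) built on positions 1..N
-- (nothing if N positions do not suffice)
buildW : ℕ → Triple → Maybe (List ℤ)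
buildW N τ = blocks 0 τ (replicate N nothing) [] >>= λ where
  (ss , used) → fill (filter (λ c → ¬? (c ∈? used)) (rangeFrom 1 (N ℕ.+ length used))) ss

oneLine : ∀ {n} → SignedPerm n → ℕ → List ℤ
oneLine w N = map (λ i → app w (+ i)) (rangeFrom 1 N)

-- w is vexillary iff w = w(τ) (as signed permutations of ℤ) for a triple τ;
-- equality is checked on positions 1..N for any N ≥ n large enough for
-- the construction (beyond N both sides are the identity).
Vexillary : ∀ {n} → SignedPerm n → Set
Vexillary {n} w = Σ Triple λ τ → IsTriple τ × Σ ℕ λ N → (n ℕ.≤ N) × (buildW N τ ≡ just (oneLine w N))

InR : ℕ → ℤ → Set
InR n x = (ℤ.- (+ n) ℤ.≤ x) × (x ℤ.≤ + n)

-- ι(w) : the permutation of {-n..n} with ι(w)(i) = w(i)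
ι : ∀ {n} → SignedPerm n → ℤ → ℤ
ι w = app w

InD : ℕ → (ℤ → ℤ) → ℤ → ℤ → Set
InD n v a b = InR n a × InR n b × (a ℤ.< v b) ×
              (Σ ℤ λ j → InR n j × (v j ≡ a) × (b ℤ.< j))

InDtilde : ∀ {n} → SignedPerm n → ℤ → ℤ → Set
InDtilde {n} w a b = InD n (ι w) a b × (b ℤ.≤ ℤ.- (+ 1))

SECorner : ∀ {n} → SignedPerm n → ℤ → ℤ → Set
SECorner w a b = InDtilde w a b × ¬ InDtilde w (a ℤ.+ + 1) b × ¬ InDtilde w a (b ℤ.+ + 1)

-- r_w(p,q) = #{ i : -n ≤ i ≤ -p, w(i) ≥ q }   (i = -j, p ≤ j ≤ n)
rank : ∀ {n} → SignedPerm n → ℕ → ℤ → ℕ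
rank {n} w p q =
  length (filter (λ j → q ℤ.≤? app w (ℤ.- (+ j)))
                 (filter (λ j → p ℕ.≤? j) (rangeFrom 0 (suc n))))

InEss : ∀ {n} → SignedPerm n → ℕ → ℕ → ℤ → Set
InEss w k p q =
  SECorner w (q ℤ.- + 1) (ℤ.- (+ p)) ×
  (k ≡ rank w p q) ×
  ¬ ((p ≡ 1) × (q ℤ.< + 0)) ×
  ¬ ((1 ℕ.< p) × (+ 0 ℤ.< q) × SECorner w (ℤ.- q) (ℤ.- (+ p)) ×
     (k ≡ rank w p q) ×
     (+ rank w p q ≡ (+ rank w p (ℤ.- q ℤ.+ + 1)) ℤ.- q ℤ.+ + 1))

EssPos : ∀ {n} → SignedPerm n → ℕ × ℤ → Set
EssPos w (p , q) = Σ ℕ λ k → InEss w k p q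

VexillaryPerm : ℕ → (ℤ → ℤ) → Set
VexillaryPerm n v = ∀ a b c d → InR n a → InR n b → InR n c → InR n d →
  a ℤ.< b → b ℤ.< c → c ℤ.< d →
  ¬ ((v b ℤ.< v a) × (v a ℤ.< v d) × (v d ℤ.< v c))

{-# OPTIONS --safe #-}
module Submission where

-- Vexillary ⇔ avoiding.  In a signed permutation w whose ι(w) avoids 2143 the
-- positive values increase, so w is determined by the points (i , c) with
-- w(i) = -c < 0.  For these, avoidance means: if b < d carry C > D, then either
-- all positions between b and d carry values above D, or all values between D
-- and C occur at positions after b.  Each block of the construction of w(τ)
-- preserves this condition, because the inequality on p, q, k keeps a new point
-- out of the region i ≥ pᵢ, c ≥ qᵢ of the earlier ones.  Conversely the condition
-- for the leftmost point and the point of least value shows that one of the two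
-- can have been placed last, as a block of size one with p the least position
-- and q the least value; removing it preserves the condition.
--
-- Avoiding ⇔ ordered essential positions.  A descent of v = ι(w) contains a SE
-- corner of D(v) in its rectangle, so v avoids 2143 iff no corner is strictly NW
-- of another.  Corners come in pairs (r , c), (-r-1 , -c-1), so it suffices to
-- consider columns ≤ -1, and there a corner in a negative row is strictly NW of
-- its mirror image.

open import Defs
open import Data.Nat as ℕ using (ℕ; zero; suc; _≤_; _<_; _+_; _∸_; z≤n; s≤s)
open import Data.Nat.Properties as ℕₚ using (≤-refl; ≤-trans; <-trans; ≤-<-trans; <-≤-trans; <-irrefl; <⇒≤; ≤-reflexive; +-suc; +-identityʳ; ≤-pred; ≤∧≢⇒<; <-cmp; n≤1+n)
open import Data.Integer as ℤ using (ℤ; +_; -[1+_]; ∣_∣; -_)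
import Data.Integer.Properties as ℤₚ
open import Data.Product using (Σ; ∃; ∃₂; _×_; _,_; proj₁; proj₂)
open import Data.Sum using (_⊎_; inj₁; inj₂; [_,_]′)
open import Data.Empty using (⊥; ⊥-elim)
open import Data.Maybe as Maybe using (Maybe; just; nothing; _>>=_)
open import Data.Maybe.Properties using (just-injective; ≡-dec)
open import Data.List using (List; []; _∷_; _++_; map; filter; take; reverse; length; replicate; downFrom; cartesianProduct)
open import Data.List.Properties using (length-++; length-map; filter-++; filter-reject; filter-accept; unfold-reverse; length-take)
open import Data.List.Membership.DecPropositional ℕ._≟_ using (_∈?_)
open import Data.List.Membership.DecPropositional (≡-dec ℤ._≟_) using () renaming (_∈?_ to _∈ₛ?_)
open import Data.List.Membership.Propositional using (_∈_; _∉_)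
open import Data.List.Membership.Propositional.Properties using (∈-++⁺ˡ; ∈-++⁺ʳ; ∈-++⁻; ∈-∃++; ∈-filter⁺; ∈-filter⁻; ∈-map⁺; ∈-map⁻; ∈-downFrom⁺; ∈-cartesianProduct⁺; ∈-cartesianProduct⁻)
open import Data.List.Relation.Unary.Any using (here; there)
open import Data.List.Relation.Unary.All as All using (All; []; _∷_)
open import Data.List.Relation.Unary.AllPairs as AllPairs using (AllPairs; []; _∷_)
open import Data.List.Relation.Unary.Linked as Linked using (Linked; []; [-]; _∷_)
open import Data.List.Relation.Unary.Unique.Propositional using (Unique)
open import Data.List.Relation.Unary.Linked.Properties using (AllPairs⇒Linked; Linked⇒AllPairs)
import Data.List.Relation.Unary.All.Properties as Allₚ
import Data.List.Relation.Unary.AllPairs.Properties as AllPairsₚ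
import Data.List.Relation.Unary.Any.Properties as Anyₚ
import Data.List.Relation.Unary.Unique.Propositional.Properties as Uniqueₚ
open import Data.List.Relation.Binary.Permutation.Propositional using (↭-sym; ↭⇒↭ₛ)
open import Data.List.Relation.Binary.Permutation.Propositional.Properties using (∈-resp-↭)
open import Data.Vec using (toList)
open import Data.Vec.Properties using (length-toList)
open import Relation.Nullary using (¬_; Dec; yes; no; ¬?)
open import Relation.Nullary.Decidable using (map′; toSum; _×-dec_)
open import Relation.Binary.PropositionalEquality using (_≡_; _≢_; refl; sym; trans; cong; subst; subst₂; setoid)
open import Data.List.Relation.Binary.Permutation.Setoid.Properties (setoid ℕ) using (Unique-resp-↭)
open import Relation.Binary.Definitions using (tri<; tri≈; tri>)
open import Function.Bundles using (_⇔_; mk⇔; Equivalence)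

private variable
  A B : Set

-- Lists with numbered positions, intervals and counting

-- Entry i xs j x: when the positions of xs are numbered i, i + 1, …, the
-- one numbered j holds x.
data Entry {A : Set} : ℕ → List A → ℕ → A → Set where
  here  : ∀ {i x xs} → Entry i (x ∷ xs) i x
  there : ∀ {i j x y xs} → Entry (suc i) xs j y → Entry i (x ∷ xs) j y

entry-≥ : ∀ {i j} {x : A} {xs} → Entry i xs j x → i ≤ j
entry-≥ here      = ≤-refl
entry-≥ (there e) = <⇒≤ (entry-≥ e)

entry-< : ∀ {i j} {x : A} {xs} → Entry i xs j x → j < i + length xs
entry-< {i = i} (here {xs = xs}) rewrite +-suc i (length xs) = s≤s (ℕₚ.m≤m+n i _)
entry-< {i = i} (there {xs = xs} e) rewrite +-suc i (length xs) = entry-< e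

entry-functional : ∀ {i j} {x y : A} {xs} → Entry i xs j x → Entry i xs j y → x ≡ y
entry-functional here      here       = refl
entry-functional here      (there e)  = ⊥-elim (<-irrefl refl (entry-≥ e))
entry-functional (there e) here       = ⊥-elim (<-irrefl refl (entry-≥ e))
entry-functional (there e) (there e′) = entry-functional e e′

entry-total : ∀ {i j} (xs : List A) → i ≤ j → j < i + length xs → ∃ (Entry i xs j)
entry-total {i = i} [] i≤j j<i = ⊥-elim (<-irrefl refl (<-≤-trans (subst (_ <_) (+-identityʳ i) j<i) i≤j))
entry-total {i = i} {j} (x ∷ xs) i≤j j<l with i ℕ.≟ j
... | yes refl = x , here
... | no  i≢j  with entry-total xs (≤∧≢⇒< i≤j i≢j) (subst (j <_) (+-suc i _) j<l)
...   | y , e = y , there e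

entry-map⁺ : ∀ (f : A → B) {i j x xs} → Entry i xs j x → Entry i (map f xs) j (f x)
entry-map⁺ f here      = here
entry-map⁺ f (there e) = there (entry-map⁺ f e)

entry-map⁻ : ∀ (f : A → B) {i j y} xs → Entry i (map f xs) j y → ∃ λ x → Entry i xs j x × y ≡ f x
entry-map⁻ f (x ∷ xs) here      = x , here , refl
entry-map⁻ f (x ∷ xs) (there e) with entry-map⁻ f xs e
... | x′ , e′ , eq = x′ , there e′ , eq

entry⇒∈ : ∀ {i j} {x : A} {xs} → Entry i xs j x → x ∈ xs
entry⇒∈ here      = here refl
entry⇒∈ (there e) = there (entry⇒∈ e)

∈⇒entry : ∀ i {x : A} {xs} → x ∈ xs → ∃ λ j → Entry i xs j x
∈⇒entry i (here refl) = i , here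
∈⇒entry i (there x∈)  with ∈⇒entry (suc i) x∈
... | j , e = j , there e

vacant : ∀ {i j N} {y : A} → ¬ Entry i (replicate N nothing) j (just y)
vacant {N = suc N} (there e) = vacant e

entry-unique : ∀ {i j k} {x : A} {xs} → Unique xs → Entry i xs j x → Entry i xs k x → j ≡ k
entry-unique _        here      here       = refl
entry-unique (x∉ ∷ _) here      (there e)  = ⊥-elim (All.lookup x∉ (entry⇒∈ e) refl)
entry-unique (x∉ ∷ _) (there e) here       = ⊥-elim (All.lookup x∉ (entry⇒∈ e) refl)
entry-unique (_ ∷ u)  (there e) (there e′) = entry-unique u e e′

∈-rangeFrom⁺ : ∀ {a c} m → a ≤ c → c < a + m → c ∈ rangeFrom a m
∈-rangeFrom⁺ {a} zero a≤c c< = ⊥-elim (<-irrefl refl (<-≤-trans (subst (_ <_) (+-identityʳ a) c<) a≤c))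
∈-rangeFrom⁺ {a} {c} (suc m) a≤c c< with a ℕ.≟ c
... | yes refl = here refl
... | no  a≢c  = there (∈-rangeFrom⁺ m (≤∧≢⇒< a≤c a≢c) (subst (c <_) (+-suc a m) c<))

∈-rangeFrom⁻ : ∀ {a c} m → c ∈ rangeFrom a m → a ≤ c × c < a + m
∈-rangeFrom⁻ {a} (suc m) (here refl) = ≤-refl , subst (a <_) (sym (+-suc a m)) (s≤s (ℕₚ.m≤m+n a m))
∈-rangeFrom⁻ {a} {c} (suc m) (there c∈) with ∈-rangeFrom⁻ m c∈
... | a<c , c< = <⇒≤ a<c , subst (c <_) (sym (+-suc a m)) c<

length-rangeFrom : ∀ a m → length (rangeFrom a m) ≡ m
length-rangeFrom a zero    = refl
length-rangeFrom a (suc m) = cong suc (length-rangeFrom (suc a) m)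

rangeFrom-sorted : ∀ a m → AllPairs _<_ (rangeFrom a m)
rangeFrom-sorted a zero    = []
rangeFrom-sorted a (suc m) = All.tabulate (λ c∈ → proj₁ (∈-rangeFrom⁻ m c∈)) ∷ rangeFrom-sorted (suc a) m

rangeFrom-++ : ∀ a m k → rangeFrom a (m + k) ≡ rangeFrom a m ++ rangeFrom (a + m) k
rangeFrom-++ a zero    k rewrite +-identityʳ a = refl
rangeFrom-++ a (suc m) k rewrite +-suc a m = cong (a ∷_) (rangeFrom-++ (suc a) m k)

entry-rangeFrom : ∀ {i j c} m → Entry i (rangeFrom i m) j c → c ≡ j
entry-rangeFrom (suc m) here      = refl
entry-rangeFrom (suc m) (there e) = entry-rangeFrom m e

sorted⇒unique : ∀ {xs} → AllPairs _<_ xs → Unique xs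
sorted⇒unique = AllPairs.map λ { x<x refl → <-irrefl refl x<x }

-- Pigeonhole principle. It turns the points forced into a block into a lower bound for the size of
-- the block in `exceeds`, and bounds a gap of values by `length used` in `smallestUnused-one`.
unique-⊆-length : ∀ {xs ys : List A} → Unique xs → (∀ {x} → x ∈ xs → x ∈ ys) → length xs ≤ length ys
unique-⊆-length [] _ = z≤n
unique-⊆-length {xs = x ∷ xs} (x∉ ∷ u) sub with ∈-∃++ (sub (here refl))
... | as , bs , refl = subst (suc (length xs) ≤_) eq (s≤s (unique-⊆-length u sub′))
  where
  eq : suc (length (as ++ bs)) ≡ length (as ++ x ∷ bs)
  eq rewrite length-++ as {bs} | length-++ as {x ∷ bs} = sym (+-suc (length as) (length bs))
  sub′ : ∀ {y} → y ∈ xs → y ∈ as ++ bs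
  sub′ {y} y∈ with ∈-++⁻ as (sub (there y∈))
  ... | inj₁ y∈as         = ∈-++⁺ˡ y∈as
  ... | inj₂ (here refl)  = ⊥-elim (All.lookup x∉ y∈ refl)
  ... | inj₂ (there y∈bs) = ∈-++⁺ʳ as y∈bs

sorted-extensional : ∀ {xs ys} → AllPairs _<_ xs → AllPairs _<_ ys →
                     (∀ {x} → x ∈ xs → x ∈ ys) → (∀ {x} → x ∈ ys → x ∈ xs) → xs ≡ ys
sorted-extensional [] [] _ _ = refl
sorted-extensional [] (_ ∷ _) _ g with () ← g (here refl)
sorted-extensional (_ ∷ _) [] f _ with () ← f (here refl)
sorted-extensional {x ∷ xs} {y ∷ ys} (x< ∷ sx) (y< ∷ sy) f g with head≡
  where
  head≡ : x ≡ y
  head≡ with f (here refl) | g (here refl)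
  ... | here eq  | _         = eq
  ... | there _  | here eq   = sym eq
  ... | there x∈ | there y∈  = ⊥-elim (<-irrefl refl (<-trans (All.lookup y< x∈) (All.lookup x< y∈)))
... | refl = cong (x ∷_) (sorted-extensional sx sy f′ g′)
  where
  f′ : ∀ {z} → z ∈ xs → z ∈ ys
  f′ z∈ with f (there z∈)
  ... | here refl  = ⊥-elim (<-irrefl refl (All.lookup x< z∈))
  ... | there z∈ys = z∈ys
  g′ : ∀ {z} → z ∈ ys → z ∈ xs
  g′ z∈ with g (there z∈)
  ... | here refl  = ⊥-elim (<-irrefl refl (All.lookup y< z∈))
  ... | there z∈xs = z∈xs

-- Placement of a block

-- The graph of the successful runs of `place`, with the test on `p` and `i` turned into a premise,
-- so that properties of a run follow by induction on it.
data Placed : ℕ → ℕ → List ℤ → List (Maybe ℤ) → List (Maybe ℤ) → Set where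
  done : ∀ {i p ss} → Placed i p [] ss ss
  skip : ∀ {i p x xs y ss ss′} → Placed (suc i) p (x ∷ xs) ss ss′ →
         Placed i p (x ∷ xs) (just y ∷ ss) (just y ∷ ss′)
  put  : ∀ {i p x xs ss ss′} → p ≤ i → Placed (suc i) p xs ss ss′ →
         Placed i p (x ∷ xs) (nothing ∷ ss) (just x ∷ ss′)
  low  : ∀ {i p x xs ss ss′} → i < p → Placed (suc i) p (x ∷ xs) ss ss′ →
         Placed i p (x ∷ xs) (nothing ∷ ss) (nothing ∷ ss′)

Maybe-map⁻ : ∀ {f : A → B} m {y} → Maybe.map f m ≡ just y → ∃ λ x → m ≡ just x × y ≡ f x
Maybe-map⁻ (just x) refl = x , refl , refl

place⇒Placed : ∀ i p xs ss {ss′} → place i p xs ss ≡ just ss′ → Placed i p xs ss ss′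
place⇒Placed i p [] ss refl = done
place⇒Placed i p (x ∷ xs) (just y ∷ ss) eq with Maybe-map⁻ (place (suc i) p (x ∷ xs) ss) eq
... | _ , eq′ , refl = skip (place⇒Placed (suc i) p (x ∷ xs) ss eq′)
place⇒Placed i p (x ∷ xs) (nothing ∷ ss) eq with p ℕ.≤? i
... | yes p≤i with Maybe-map⁻ (place (suc i) p xs ss) eq
...   | _ , eq′ , refl = put p≤i (place⇒Placed (suc i) p xs ss eq′)
place⇒Placed i p (x ∷ xs) (nothing ∷ ss) eq | no p≰i with Maybe-map⁻ (place (suc i) p (x ∷ xs) ss) eq
... | _ , eq′ , refl = low (ℕₚ.≰⇒> p≰i) (place⇒Placed (suc i) p (x ∷ xs) ss eq′)

Placed⇒place : ∀ {i p xs ss ss′} → Placed i p xs ss ss′ → place i p xs ss ≡ just ss′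
Placed⇒place done = refl
Placed⇒place (skip pl) rewrite Placed⇒place pl = refl
Placed⇒place {i} {p} (put p≤i pl) with p ℕ.≤? i
... | yes _   rewrite Placed⇒place pl = refl
... | no  p≰i = ⊥-elim (p≰i p≤i)
Placed⇒place {i} {p} (low i<p pl) with p ℕ.≤? i
... | yes p≤i = ⊥-elim (<-irrefl refl (<-≤-trans i<p p≤i))
... | no  _   rewrite Placed⇒place pl = refl

placed-old : ∀ {i p xs ss ss′ j y} → Placed i p xs ss ss′ → Entry i ss j (just y) → Entry i ss′ j (just y)
placed-old done       e         = e
placed-old (skip pl)  here      = here
placed-old (skip pl)  (there e) = there (placed-old pl e)
placed-old (put _ pl) (there e) = there (placed-old pl e)
placed-old (low _ pl) (there e) = there (placed-old pl e)

-- New points are recognised by comparing the lists before and after a block, since the later list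
-- does not record which block filled a position.
data New : ℕ → List (Maybe ℤ) → List (Maybe ℤ) → ℕ → ℤ → Set where
  here  : ∀ {i y ss ss′} → New i (nothing ∷ ss) (just y ∷ ss′) i y
  there : ∀ {i j m m′ y ss ss′} → New (suc i) ss ss′ j y → New i (m ∷ ss) (m′ ∷ ss′) j y

new-before : ∀ {i ss ss′ j y} → New i ss ss′ j y → Entry i ss j nothing
new-before here      = here
new-before (there n) = there (new-before n)

new-after : ∀ {i ss ss′ j y} → New i ss ss′ j y → Entry i ss′ j (just y)
new-after here      = here
new-after (there n) = there (new-after n)

new-≥ : ∀ {i ss ss′ j y} → New i ss ss′ j y → i ≤ j
new-≥ n = entry-≥ (new-after n)

¬new-refl : ∀ {i ss j y} → ¬ New i ss ss j y
¬new-refl (there n) = ¬new-refl n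

placed-split : ∀ {i p xs ss ss′ j y} → Placed i p xs ss ss′ → Entry i ss′ j (just y) →
               Entry i ss j (just y) ⊎ New i ss ss′ j y
placed-split done         e         = inj₁ e
placed-split (skip pl)    here      = inj₁ here
placed-split (put p≤i pl) here      = inj₂ here
placed-split (skip pl)    (there e) = [ (λ e′ → inj₁ (there e′)) , (λ n → inj₂ (there n)) ]′ (placed-split pl e)
placed-split (put p≤i pl) (there e) = [ (λ e′ → inj₁ (there e′)) , (λ n → inj₂ (there n)) ]′ (placed-split pl e)
placed-split (low i<p pl) (there e) = [ (λ e′ → inj₁ (there e′)) , (λ n → inj₂ (there n)) ]′ (placed-split pl e)

new-∈ : ∀ {i p xs ss ss′ j y} → Placed i p xs ss ss′ → New i ss ss′ j y → y ∈ xs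
new-∈ done       n         = ⊥-elim (¬new-refl n)
new-∈ (skip pl)  (there n) = new-∈ pl n
new-∈ (put _ pl) here      = here refl
new-∈ (put _ pl) (there n) = there (new-∈ pl n)
new-∈ (low _ pl) (there n) = new-∈ pl n

new-bound : ∀ {i p xs ss ss′ j y} → Placed i p xs ss ss′ → New i ss ss′ j y → p ≤ j
new-bound done         n         = ⊥-elim (¬new-refl n)
new-bound (skip pl)    (there n) = new-bound pl n
new-bound (put p≤i pl) here      = p≤i
new-bound (put _ pl)   (there n) = new-bound pl n
new-bound (low _ pl)   (there n) = new-bound pl n

-- The run passes `j` before it reaches `k`, with a value still left to place, so a vacancy at `j`
-- is filled on the way.
placed-first-vacant : ∀ {i p xs ss ss′ j k y} → Placed i p xs ss ss′ → New i ss ss′ k y →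
                      i ≤ j → p ≤ j → j < k → ∃ λ z → Entry i ss′ j (just z)
placed-first-vacant done n _ _ _ = ⊥-elim (¬new-refl n)
placed-first-vacant (skip pl) (there n) i≤j p≤j j<k with ℕₚ.m≤n⇒m<n∨m≡n i≤j
... | inj₂ refl = _ , here
... | inj₁ i<j  = let z , e = placed-first-vacant pl n i<j p≤j j<k in z , there e
placed-first-vacant (put _ pl) here i≤j _ j<k = ⊥-elim (<-irrefl refl (≤-<-trans i≤j j<k))
placed-first-vacant (put _ pl) (there n) i≤j p≤j j<k with ℕₚ.m≤n⇒m<n∨m≡n i≤j
... | inj₂ refl = _ , here
... | inj₁ i<j  = let z , e = placed-first-vacant pl n i<j p≤j j<k in z , there e
placed-first-vacant (low i<p pl) (there n) i≤j p≤j j<k =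
  let z , e = placed-first-vacant pl n (<-≤-trans i<p p≤j) p≤j j<k in z , there e

placed-monotone : ∀ {i p xs ss ss′ j k y z} → AllPairs ℤ._<_ xs → Placed i p xs ss ss′ →
                  New i ss ss′ j y → New i ss ss′ k z → j < k → y ℤ.< z
placed-monotone _        done       n         _          _   = ⊥-elim (¬new-refl n)
placed-monotone s        (skip pl)  (there n) (there n′) j<k = placed-monotone s pl n n′ j<k
placed-monotone s        (low _ pl) (there n) (there n′) j<k = placed-monotone s pl n n′ j<k
placed-monotone s        (put _ pl) here      here       j<k = ⊥-elim (<-irrefl refl j<k)
placed-monotone (x< ∷ _) (put _ pl) here      (there n′) j<k = All.lookup x< (new-∈ pl n′)
placed-monotone s        (put _ pl) (there n) here       j<k = ⊥-elim (<-irrefl refl (<-trans j<k (new-≥ n)))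
placed-monotone (_ ∷ s)  (put _ pl) (there n) (there n′) j<k = placed-monotone s pl n n′ j<k

placed-all : ∀ {i p xs ss ss′ y} → Placed i p xs ss ss′ → y ∈ xs → ∃ λ j → New i ss ss′ j y
placed-all (skip pl)  y∈          = let j , n = placed-all pl y∈ in j , there n
placed-all (put _ pl) (here refl) = _ , here
placed-all (put _ pl) (there y∈)  = let j , n = placed-all pl y∈ in j , there n
placed-all (low _ pl) y∈          = let j , n = placed-all pl y∈ in j , there n

-- Preservation of the pair condition by blocks

reverse-pairs : ∀ {R : A → A → Set} {xs} → AllPairs R xs → AllPairs (λ x y → R y x) (reverse xs)
reverse-pairs [] = []
reverse-pairs {R = R} {x ∷ xs} (x< ∷ s) rewrite unfold-reverse x xs =
  AllPairsₚ.++⁺ (reverse-pairs s) ([] ∷ []) (All.tabulate λ y∈ → All.lookup x< (Anyₚ.reverse⁻ y∈) ∷ [])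

neg : ℕ → ℤ
neg c = ℤ.- (+ c)

neg-injective : ∀ {c d} → neg c ≡ neg d → c ≡ d
neg-injective eq = ℤₚ.+-injective (ℤₚ.neg-injective eq)

neg-mono : ∀ {c d} → c < d → neg d ℤ.< neg c
neg-mono c<d = ℤₚ.neg-mono-< (ℤ.+<+ c<d)

neg-cancel : ∀ {c d} → neg d ℤ.< neg c → c < d
neg-cancel lt = ℤₚ.drop‿+<+ (ℤₚ.neg-cancel-< lt)

∈-reverse-neg⁻ : ∀ {c} xs → neg c ∈ reverse (map neg xs) → c ∈ xs
∈-reverse-neg⁻ xs c∈ with ∈-map⁻ neg (Anyₚ.reverse⁻ c∈)
... | d , d∈ , eq = subst (_∈ xs) (sym (neg-injective eq)) d∈

∈-take⁻ : ∀ {x : A} {xs} m → x ∈ take m xs → x ∈ xs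
∈-take⁻ {xs = _ ∷ _} (suc m) (here eq)  = here eq
∈-take⁻ {xs = _ ∷ _} (suc m) (there x∈) = there (∈-take⁻ m x∈)

unused-sound : ∀ {c} m q used → c ∈ smallestUnused m q used → q ≤ c × c ∉ used
unused-sound m q used c∈
  with ∈-filter⁻ (λ c → ¬? (c ∈? used)) {xs = rangeFrom q (m + length used)} (∈-take⁻ m c∈)
... | c∈r , c∉ = proj₁ (∈-rangeFrom⁻ _ c∈r) , c∉

∈-take-sorted : ∀ {c x zs} m → AllPairs _<_ zs → c ∈ take m zs → x ∈ zs → x < c → x ∈ take m zs
∈-take-sorted (suc m) (z< ∷ s) c∈ (here refl) x<c = here refl
∈-take-sorted (suc m) (z< ∷ s) (here refl) (there x∈) x<c = ⊥-elim (<-irrefl refl (<-trans x<c (All.lookup z< x∈)))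
∈-take-sorted (suc m) (z< ∷ s) (there c∈) (there x∈) x<c = there (∈-take-sorted m s c∈ x∈ x<c)

filtered-sorted : ∀ q l used → AllPairs _<_ (filter (λ c → ¬? (c ∈? used)) (rangeFrom q l))
filtered-sorted q l used = AllPairsₚ.filter⁺ (λ c → ¬? (c ∈? used)) (rangeFrom-sorted q l)

unused-sorted : ∀ m q used → AllPairs _<_ (smallestUnused m q used)
unused-sorted m q used = AllPairsₚ.take⁺ m (filtered-sorted q (m + length used) used)

unused-downward : ∀ {c x} m q used → c ∈ smallestUnused m q used → q ≤ x → x ∉ used → x < c →
                  x ∈ smallestUnused m q used
unused-downward {c} {x} m q used c∈ q≤x x∉ x<c =
  ∈-take-sorted m (filtered-sorted q (m + length used) used) c∈
    (∈-filter⁺ (λ c → ¬? (c ∈? used)) (∈-rangeFrom⁺ _ q≤x (<-trans x<c c<)) x∉) x<c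
  where
  c< : c < q + (m + length used)
  c< = proj₂ (∈-rangeFrom⁻ _ (proj₁ (∈-filter⁻ (λ c → ¬? (c ∈? used)) {xs = rangeFrom q (m + length used)} (∈-take⁻ m c∈))))

-- The partial permutation matrix of the negative values: position i holds -c.
Pt : List (Maybe ℤ) → ℕ → ℕ → Set
Pt ss i c = Entry 1 ss i (just (neg c))

pt-functional : ∀ {ss i c d} → Pt ss i c → Pt ss i d → c ≡ d
pt-functional P Q = neg-injective (just-injective (entry-functional P Q))

FilledBetween : List (Maybe ℤ) → ℕ → ℕ → ℕ → Set
FilledBetween ss b d D = ∀ i → b < i → i < d → ∃ λ E → Pt ss i E × D < E

UsedBetween : List (Maybe ℤ) → ℕ → ℕ → ℕ → Set
UsedBetween ss D C b = ∀ x → D < x → x < C → ∃ λ i → Pt ss i x × b < i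

-- `pair` says that no 2143 pattern b′ b c d of ι(w) has its last three
-- positions positive and its last value negative: a gap in the positions
-- provides c and a gap in the values provides b′.
record Good (ss : List (Maybe ℤ)) : Set where
  field
    negative  : ∀ {i y} → Entry 1 ss i (just y) → ∃ λ c → 0 < c × y ≡ neg c
    injective : ∀ {i j c} → Pt ss i c → Pt ss j c → i ≡ j
    pair      : ∀ {b d C D} → Pt ss b C → Pt ss d D → b < d → D < C →
                FilledBetween ss b d D ⊎ UsedBetween ss D C b

record Uses (ss : List (Maybe ℤ)) (used : List ℕ) : Set where
  field
    sound    : ∀ {c} → c ∈ used → ∃ λ i → Pt ss i c
    complete : ∀ {i c} → Pt ss i c → c ∈ used

Bounded : List (Maybe ℤ) → ℕ → ℕ → Set
Bounded ss p q = ∀ {i c} → Pt ss i c → p ≤ i × q ≤ c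

Empty : List (Maybe ℤ) → Set
Empty ss = ∀ {i c} → ¬ Pt ss i c

-- `m` is the preceding `k` of the triple. After the first block, `p₀` and `q₀` are instantiated
-- with the preceding `p` and `q`, and the last inequality is the one required of a triple; before
-- the first block the list is empty.
Ready : ℕ → ℕ × ℕ × ℕ → List (Maybe ℤ) → Set
Ready m (k , p , q) ss = Empty ss ⊎
  ∃₂ λ p₀ q₀ → Bounded ss p₀ q₀ × p ≤ p₀ × q ≤ q₀ × k ∸ m ≤ (p₀ ∸ p) + (q₀ ∸ q)

module Block {ss ss′ : List (Maybe ℤ)} {used : List ℕ} {m k p q : ℕ} (good : Good ss) (uses : Uses ss used) (0<p : 0 < p) (0<q : 0 < q)
  (ready : Ready m (k , p , q) ss) where

  vals : List ℕ
  vals = smallestUnused (k ∸ m) q used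

  module _ (pl : Placed 1 p (reverse (map neg vals)) ss ss′) where

    open Good good
    open Uses uses

    NewPt : ℕ → ℕ → Set
    NewPt i c = New 1 ss ss′ i (neg c)

    new-val : ∀ {i c} → NewPt i c → c ∈ vals
    new-val n = ∈-reverse-neg⁻ vals (new-∈ pl n)

    new-vals : ∀ {c} → c ∈ vals → ∃ λ i → NewPt i c
    new-vals c∈ = placed-all pl (Anyₚ.reverse⁺ (∈-map⁺ neg c∈))

    vals-sorted : AllPairs ℤ._<_ (reverse (map neg vals))
    vals-sorted = reverse-pairs (AllPairsₚ.map⁺ (AllPairs.map neg-mono (unused-sorted (k ∸ m) q used)))

    antitone : ∀ {i j c d} → NewPt i c → NewPt j d → i < j → d < c
    antitone n n′ i<j = neg-cancel (placed-monotone vals-sorted pl n n′ i<j)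

    old : ∀ {i c} → Pt ss i c → Pt ss′ i c
    old = placed-old pl

    old-bounded : Bounded ss p q
    old-bounded P = [ (λ empty → ⊥-elim (empty P))
                    , (λ { (_ , _ , bd , p≤ , q≤ , _) → ≤-trans p≤ (proj₁ (bd P)) , ≤-trans q≤ (proj₂ (bd P)) }) ]′ ready

    new-bounded : ∀ {i c} → NewPt i c → p ≤ i × q ≤ c
    new-bounded n = new-bound pl n , proj₁ (unused-sound (k ∸ m) q used (new-val n))

    bounded : Bounded ss′ p q
    bounded P = [ old-bounded , new-bounded ]′ (placed-split pl P)

    negative′ : ∀ {i y} → Entry 1 ss′ i (just y) → ∃ λ c → 0 < c × y ≡ neg c
    negative′ e with placed-split pl e
    ... | inj₁ e₀ = negative e₀
    ... | inj₂ n with ∈-map⁻ neg (Anyₚ.reverse⁻ {xs = map neg vals} (new-∈ pl n))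
    ...   | c , c∈ , refl = c , <-≤-trans 0<q (proj₁ (unused-sound (k ∸ m) q used c∈)) , refl

    filled : ∀ {i j c} → NewPt j c → 0 < i → p ≤ i → i < j → ∃ λ E → Pt ss i E ⊎ NewPt i E
    filled n 0<i p≤i i<j with placed-first-vacant pl n 0<i p≤i i<j
    ... | y , e with negative′ e
    ...   | E , _ , refl = E , placed-split pl e

    new-injective : ∀ {i j c} → NewPt i c → NewPt j c → i ≡ j
    new-injective {i} {j} n n′ with <-cmp i j
    ... | tri< i<j _ _ = ⊥-elim (<-irrefl refl (antitone n n′ i<j))
    ... | tri≈ _ eq _  = eq
    ... | tri> _ _ j<i = ⊥-elim (<-irrefl refl (antitone n′ n j<i))

    -- With i ≥ p₀ and c ≥ q₀, the block would contain, besides (i , c), a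
    -- point in each of the positions p, …, p₀ - 1 and one for each of the
    -- values q, …, q₀ - 1, hence more than k - m points.
    exceeds : ∀ p₀ q₀ → Bounded ss p₀ q₀ → p ≤ p₀ → q ≤ q₀ → k ∸ m ≤ (p₀ ∸ p) + (q₀ ∸ q) →
              ∀ {i c} → NewPt i c → i < p₀ ⊎ c < q₀
    exceeds p₀ q₀ bd p≤ q≤ count {i} {c} n with i ℕ.<? p₀ | c ℕ.<? q₀
    ... | yes i< | _      = inj₁ i<
    ... | no _   | yes c< = inj₂ c<
    ... | no i≮  | no c≮  = ⊥-elim (<-irrefl refl (≤-trans (≤-reflexive (sym len)) (≤-trans short count)))
      where
      p₀≤i : p₀ ≤ i
      p₀≤i = ℕₚ.≮⇒≥ i≮
      q₀≤c : q₀ ≤ c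
      q₀≤c = ℕₚ.≮⇒≥ c≮
      s<s+suc : ∀ s l → s < s + suc l
      s<s+suc s l = subst (s <_) (sym (+-suc s l)) (s≤s (ℕₚ.m≤m+n s l))
      -- The block reaches `i`, so the `l` positions from `s` on, all below `p₀`, are occupied. Old
      -- points lie at `p₀` or later, so the occupants are new.
      column : ∀ s l → 0 < s → p ≤ s → s + l ≤ p₀ →
               ∃ λ Es → length Es ≡ l × Unique Es × (∀ {E} → E ∈ Es → ∃ λ j → s ≤ j × j < i × NewPt j E)
      column s zero _ _ _ = [] , refl , [] , λ ()
      column s (suc l) 0<s p≤s s+l≤ with filled n 0<s p≤s (<-≤-trans (s<s+suc s l) (≤-trans s+l≤ p₀≤i))
      ... | E , inj₁ P  = ⊥-elim (<-irrefl refl (<-≤-trans (s<s+suc s l) (≤-trans s+l≤ (proj₁ (bd P)))))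
      ... | E , inj₂ nE with column (suc s) l (s≤s z≤n) (≤-trans p≤s (n≤1+n s)) (subst (_≤ p₀) (+-suc s l) s+l≤)
      ...   | Es , lEs , uEs , sp = E ∷ Es , cong suc lEs , All.tabulate fresh ∷ uEs , sp′
        where
        fresh : ∀ {E′} → E′ ∈ Es → E ≢ E′
        fresh E∈ refl with sp E∈
        ... | j , s<j , _ , nj = <-irrefl (new-injective nE nj) s<j
        sp′ : ∀ {E′} → E′ ∈ E ∷ Es → ∃ λ j → s ≤ j × j < i × NewPt j E′
        sp′ (here refl) = s , ≤-refl , <-≤-trans (s<s+suc s l) (≤-trans s+l≤ p₀≤i) , nE
        sp′ (there E∈) with sp E∈
        ... | j , s<j , j<i , nj = j , <⇒≤ s<j , j<i , nj
      cols : ∃ λ Es → length Es ≡ p₀ ∸ p × Unique Es × (∀ {E} → E ∈ Es → ∃ λ j → p ≤ j × j < i × NewPt j E)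
      cols = column p (p₀ ∸ p) 0<p ≤-refl (≤-reflexive (ℕₚ.m+[n∸m]≡n p≤))
      Es : List ℕ
      Es = proj₁ cols
      c<Es : ∀ {E} → E ∈ Es → c < E
      c<Es E∈ with proj₂ (proj₂ (proj₂ cols)) E∈
      ... | j , _ , j<i , nj = antitone nj n j<i
      row : List ℕ
      row = rangeFrom q (q₀ ∸ q)
      row-bounds : ∀ {x} → x ∈ row → q ≤ x × x < q₀
      row-bounds x∈ with ∈-rangeFrom⁻ (q₀ ∸ q) x∈
      ... | q≤x , x< = q≤x , subst (_ <_) (ℕₚ.m+[n∸m]≡n q≤) x<
      witnesses : List ℕ
      witnesses = row ++ c ∷ Es
      -- The three parts are separated by size: the row lies below `q₀ ≤ c`, and the values in `Es`,
      -- being placed to the left of `i`, exceed `c`.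
      unique : Unique witnesses
      unique = Uniqueₚ.++⁺ (sorted⇒unique (rangeFrom-sorted q (q₀ ∸ q)))
                 (All.tabulate (λ { E∈ refl → <-irrefl refl (c<Es E∈) }) ∷ proj₁ (proj₂ (proj₂ cols)))
                 λ { (x∈ , here refl) → <-irrefl refl (<-≤-trans (proj₂ (row-bounds x∈)) q₀≤c)
                   ; (x∈ , there E∈) → <-irrefl refl (<-trans (<-≤-trans (proj₂ (row-bounds x∈)) q₀≤c) (c<Es E∈)) }
      inside : ∀ {x} → x ∈ witnesses → x ∈ vals
      inside x∈ with ∈-++⁻ row x∈
      ... | inj₂ (here refl) = new-val n
      ... | inj₂ (there E∈)  = new-val (proj₂ (proj₂ (proj₂ (proj₂ (proj₂ (proj₂ cols)) E∈))))
      ... | inj₁ x∈row       = unused-downward (k ∸ m) q used (new-val n) (proj₁ (row-bounds x∈row))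
              (λ x∈used → <-irrefl refl (<-≤-trans (proj₂ (row-bounds x∈row)) (proj₂ (bd (proj₂ (sound x∈used))))))
              (<-≤-trans (proj₂ (row-bounds x∈row)) q₀≤c)
      short : length witnesses ≤ k ∸ m
      short = ≤-trans (unique-⊆-length unique inside)
                (≤-trans (≤-reflexive (length-take (k ∸ m) _)) (ℕₚ.m⊓n≤m (k ∸ m) _))
      len : length witnesses ≡ suc ((p₀ ∸ p) + (q₀ ∸ q))
      len rewrite length-++ row {c ∷ Es} | length-rangeFrom q (q₀ ∸ q) | proj₁ (proj₂ cols) =
        trans (+-suc (q₀ ∸ q) (p₀ ∸ p)) (cong suc (ℕₚ.+-comm (q₀ ∸ q) (p₀ ∸ p)))

    -- The bounds `p₀` and `q₀` of `exceeds` hold for all old points at once. This is the form in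
    -- which the inequality on `k` enters `pair′`.
    separated : ∀ {i c} → NewPt i c → (∀ {i₀ c₀} → Pt ss i₀ c₀ → i < i₀) ⊎ (∀ {i₀ c₀} → Pt ss i₀ c₀ → c < c₀)
    separated {i} {c} n = from-ready ready
      where
      from-ready : Ready m (k , p , q) ss →
                   (∀ {i₀ c₀} → Pt ss i₀ c₀ → i < i₀) ⊎ (∀ {i₀ c₀} → Pt ss i₀ c₀ → c < c₀)
      from-ready (inj₁ empty) = inj₁ λ P → ⊥-elim (empty P)
      from-ready (inj₂ (p₀ , q₀ , bd , p≤ , q≤ , count)) with exceeds p₀ q₀ bd p≤ q≤ count n
      ... | inj₁ i< = inj₁ λ P → <-≤-trans i< (proj₁ (bd P))
      ... | inj₂ c< = inj₂ λ P → <-≤-trans c< (proj₂ (bd P))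

    injective′ : ∀ {i j c} → Pt ss′ i c → Pt ss′ j c → i ≡ j
    injective′ P Q with placed-split pl P | placed-split pl Q
    ... | inj₁ P₀ | inj₁ Q₀ = injective P₀ Q₀
    ... | inj₁ P₀ | inj₂ nQ = ⊥-elim (proj₂ (unused-sound (k ∸ m) q used (new-val nQ)) (complete P₀))
    ... | inj₂ nP | inj₁ Q₀ = ⊥-elim (proj₂ (unused-sound (k ∸ m) q used (new-val nP)) (complete Q₀))
    ... | inj₂ nP | inj₂ nQ = new-injective nP nQ

    -- If the right point is new, the block left no vacancy between `b` and `d`: new occupants lie
    -- left of `d` and so have larger values, and old ones too, because `d` is not to the left of
    -- them. If only the left point is new, its value exceeds an old one, so it lies left of all old
    -- points; the values between `D` and `C` are then old, or new and placed to its right.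
    pair′ : ∀ {b d C D} → Pt ss′ b C → Pt ss′ d D → b < d → D < C →
            FilledBetween ss′ b d D ⊎ UsedBetween ss′ D C b
    pair′ {b} {d} {C} {D} P Q b<d D<C with placed-split pl P | placed-split pl Q
    ... | inj₁ P₀ | inj₁ Q₀ with pair P₀ Q₀ b<d D<C
    ...   | inj₁ f = inj₁ λ i b<i i<d → let E , R , D<E = f i b<i i<d in E , old R , D<E
    ...   | inj₂ u = inj₂ λ x D<x x<C → let i , R , b<i = u x D<x x<C in i , old R , b<i
    pair′ {b} {d} {C} {D} P Q b<d D<C | _ | inj₂ nQ = inj₁ between
      where
      between : FilledBetween ss′ b d D
      between i b<i i<d with filled nQ (≤-trans (s≤s z≤n) b<i) (≤-trans (proj₁ (bounded P)) (<⇒≤ b<i)) i<d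
      ... | E , inj₂ nR = E , new-after nR , antitone nR nQ i<d
      ... | E , inj₁ R₀ with separated nQ
      ...   | inj₁ before = ⊥-elim (<-irrefl refl (<-trans i<d (before R₀)))
      ...   | inj₂ below  = E , old R₀ , below R₀
    pair′ {b} {d} {C} {D} P Q b<d D<C | inj₂ nP | inj₁ Q₀ with separated nP
    ... | inj₂ below  = ⊥-elim (<-irrefl refl (<-trans D<C (below Q₀)))
    ... | inj₁ before = inj₂ between
      where
      between : UsedBetween ss′ D C b
      between x D<x x<C with x ∈? used
      ... | yes x∈ = let i , R₀ = sound x∈ in i , old R₀ , before R₀
      ... | no x∉ with new-vals (unused-downward (k ∸ m) q used (new-val nP)
                                  (≤-trans (proj₂ (bounded Q)) (<⇒≤ D<x)) x∉ x<C)
      ...   | i , nR with <-cmp i b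
      ...     | tri> _ _ b<i = i , new-after nR , b<i
      ...     | tri< i<b _ _ = ⊥-elim (<-irrefl refl (<-trans x<C (antitone nR nP i<b)))
      ...     | tri≈ _ refl _ = ⊥-elim (<-irrefl (pt-functional (new-after nR) (new-after nP)) x<C)

    good′ : Good ss′
    good′ = record { negative = negative′ ; injective = injective′ ; pair = pair′ }

    uses′ : Uses ss′ (used ++ vals)
    uses′ = record { sound = sound′ ; complete = complete′ }
      where
      sound′ : ∀ {c} → c ∈ used ++ vals → ∃ λ i → Pt ss′ i c
      sound′ c∈ with ∈-++⁻ used c∈
      ... | inj₁ c∈used = let i , P = sound c∈used in i , old P
      ... | inj₂ c∈vals = let i , n = new-vals c∈vals in i , new-after n
      complete′ : ∀ {i c} → Pt ss′ i c → c ∈ used ++ vals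
      complete′ P with placed-split pl P
      ... | inj₁ P₀ = ∈-++⁺ˡ (complete P₀)
      ... | inj₂ n  = ∈-++⁺ʳ used (new-val n)

bind⁻ : ∀ (m : Maybe A) {f : A → Maybe B} {y} → (m >>= f) ≡ just y → ∃ λ x → m ≡ just x × f x ≡ just y
bind⁻ (just x) eq = x , refl , eq

-- Induction on the columns, with `Block` as the step. `Ready` is asked only of a first column, so
-- nothing remains to be shown after the last block.
blocks-good : ∀ m τ ss used {ss′ used′} → Good ss → Uses ss used → All PositiveCol τ → Linked TripleStep τ →
              (∀ {col τ′} → τ ≡ col ∷ τ′ → Ready m col ss) →
              blocks m τ ss used ≡ just (ss′ , used′) → Good ss′
blocks-good m [] ss used good _ _ _ _ refl = good
blocks-good m ((k , p , q) ∷ τ) ss used good uses ((_ , 0<p , 0<q) ∷ pos) lnk ready eq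
  with bind⁻ (place 1 p (reverse (map neg (smallestUnused (k ∸ m) q used))) ss) eq
... | ss₁ , eq₁ , eq₂ =
  blocks-good k τ ss₁ (used ++ vals) (good′ pl) (uses′ pl) pos (Linked.tail lnk) (next lnk) eq₂
  where
  open Block {m = m} {k} good uses 0<p 0<q (ready refl)
  pl : Placed 1 p (reverse (map neg vals)) ss ss₁
  pl = place⇒Placed 1 p _ ss eq₁
  next : ∀ {τ} → Linked TripleStep ((k , p , q) ∷ τ) → ∀ {col τ′} → τ ≡ col ∷ τ′ → Ready k col ss₁
  next ((_ , p≤ , q≤ , count) ∷ _) refl = inj₂ (p , q , bounded pl , p≤ , q≤ , count)

-- Filling the vacant positions

data Filled : List ℕ → List (Maybe ℤ) → List ℤ → Set where
  nil : ∀ {us} → Filled us [] []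
  old : ∀ {us y ss l} → Filled us ss l → Filled us (just y ∷ ss) (y ∷ l)
  new : ∀ {u us ss l} → Filled us ss l → Filled (u ∷ us) (nothing ∷ ss) (+ u ∷ l)

fill⇒Filled : ∀ us ss {l} → fill us ss ≡ just l → Filled us ss l
fill⇒Filled us [] refl = nil
fill⇒Filled us (just y ∷ ss) eq with Maybe-map⁻ (fill us ss) eq
... | _ , eq′ , refl = old (fill⇒Filled us ss eq′)
fill⇒Filled (u ∷ us) (nothing ∷ ss) eq with Maybe-map⁻ (fill us ss) eq
... | _ , eq′ , refl = new (fill⇒Filled us ss eq′)

filled-length : ∀ {us ss l} → Filled us ss l → length ss ≡ length l
filled-length nil     = refl
filled-length (old f) = cong suc (filled-length f)
filled-length (new f) = cong suc (filled-length f)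

filled-just : ∀ {us ss l i j y} → Filled us ss l → Entry i ss j (just y) → Entry i l j y
filled-just (old f) here      = here
filled-just (old f) (there e) = there (filled-just f e)
filled-just (new f) (there e) = there (filled-just f e)

filled-nothing : ∀ {us ss l i j} → Filled us ss l → Entry i ss j nothing → ∃ λ u → u ∈ us × Entry i l j (+ u)
filled-nothing (old f) (there e) = let u , u∈ , e′ = filled-nothing f e in u , u∈ , there e′
filled-nothing (new f) here      = _ , here refl , here
filled-nothing (new f) (there e) = let u , u∈ , e′ = filled-nothing f e in u , there u∈ , there e′

-- `fill` consumes the increasing list `us` from left to right. This is why the positive values of
-- w(τ) increase.
filled-monotone : ∀ {us ss l i j k y z} → AllPairs _<_ us → Filled us ss l →
                  Entry i ss j nothing → Entry i ss k nothing → j < k → Entry i l j y → Entry i l k z → y ℤ.< z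
filled-monotone s (old f) (there e) (there e′) j<k (there g) (there g′) = filled-monotone s f e e′ j<k g g′
filled-monotone s (old f) (there e) _ _ here _ = ⊥-elim (<-irrefl refl (entry-≥ e))
filled-monotone s (old f) _ (there e) _ _ here = ⊥-elim (<-irrefl refl (entry-≥ e))
filled-monotone s (new f) here here j<k = ⊥-elim (<-irrefl refl j<k)
filled-monotone s (new f) (there e) here j<k = ⊥-elim (<-irrefl refl (<-trans j<k (entry-≥ e)))
filled-monotone (u< ∷ s) (new f) here (there e′) j<k g g′ with filled-nothing f e′
... | u , u∈ , h = subst₂ ℤ._<_ (entry-functional here g) (entry-functional (there h) g′) (ℤ.+<+ (All.lookup u< u∈))
filled-monotone s (new f) (there e) (there e′) j<k here _ = ⊥-elim (<-irrefl refl (entry-≥ e))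
filled-monotone s (new f) (there e) (there e′) j<k _ here = ⊥-elim (<-irrefl refl (entry-≥ e′))
filled-monotone (_ ∷ s) (new f) (there e) (there e′) j<k (there g) (there g′) = filled-monotone s f e e′ j<k g g′

-- Signed permutations on ℤ

inR⁺ : ∀ {n} x → ∣ x ∣ ≤ n → InR n x
inR⁺ (+ i)    i≤n = ℤₚ.neg-≤-pos , ℤ.+≤+ i≤n
inR⁺ -[1+ i ] i<n = ℤₚ.neg-mono-≤ (ℤ.+≤+ i<n) , ℤ.-≤+

inR⁻ : ∀ {n} x → InR n x → ∣ x ∣ ≤ n
inR⁻ (+ i)    (_ , x≤n) = ℤₚ.drop‿+≤+ x≤n
inR⁻ -[1+ i ] (n≤x , _) = ℤₚ.drop‿+≤+ (ℤₚ.neg-cancel-≤ n≤x)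

inR-neg : ∀ {n} x → InR n x → InR n (- x)
inR-neg x xR = inR⁺ (- x) (subst (_≤ _) (sym (ℤₚ.∣-i∣≡∣i∣ x)) (inR⁻ x xR))

entry-at : ∀ {i j y} l → Entry i l j y → ∃ λ d → j ≡ i + d × at l d ≡ just y
entry-at {i} (x ∷ l) here = 0 , sym (+-identityʳ i) , refl
entry-at {i} (x ∷ l) (there e) with entry-at l e
... | d , refl , eq = suc d , sym (+-suc i d) , eq

at-beyond : ∀ l d → length l ≤ d → at l d ≡ nothing
at-beyond []      d       _         = refl
at-beyond (x ∷ l) (suc d) (s≤s l≤d) = at-beyond l d l≤d

abs-cases : ∀ x y → ∣ x ∣ ≡ ∣ y ∣ → x ≡ y ⊎ x ≡ - y
abs-cases (+ i)    (+ j)    refl = inj₁ refl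
abs-cases (+ i)    -[1+ j ] refl = inj₂ refl
abs-cases -[1+ i ] (+ j)    refl = inj₂ refl
abs-cases -[1+ i ] -[1+ j ] refl = inj₁ refl

neg-fixed : ∀ x → x ≡ - x → x ≡ + 0
neg-fixed (+ zero) _ = refl

module _ {n : ℕ} (w : SignedPerm n) where

  private
    values : List ℤ
    values = toList (img w)

    length-values : length values ≡ n
    length-values = length-toList (img w)

    values-app : ∀ {i y} → Entry 1 values i y → app w (+ i) ≡ y
    values-app e with entry-at values e
    ... | d , refl , eq rewrite eq = refl

    values-entry : ∀ {i} → 0 < i → i ≤ n → Entry 1 values i (app w (+ i))
    values-entry {i} 0<i i≤n with entry-total values 0<i (s≤s (subst (i ≤_) (sym length-values) i≤n))
    ... | y , e = subst (Entry 1 values i) (sym (values-app e)) e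

    abs-entry : ∀ {i} → 0 < i → i ≤ n → Entry 1 (map ∣_∣ values) i ∣ app w (+ i) ∣
    abs-entry 0<i i≤n = entry-map⁺ ∣_∣ (values-entry 0<i i≤n)

    abs-unique : Unique (map ∣_∣ values)
    abs-unique = Unique-resp-↭ (↭⇒↭ₛ (↭-sym (isPerm w))) (sorted⇒unique (rangeFrom-sorted 1 n))

  app-abs-injective : ∀ {i j} → 0 < i → i ≤ n → 0 < j → j ≤ n → ∣ app w (+ i) ∣ ≡ ∣ app w (+ j) ∣ → i ≡ j
  app-abs-injective {i} 0<i i≤n 0<j j≤n eq =
    entry-unique abs-unique (abs-entry 0<i i≤n) (subst (Entry 1 _ _) (sym eq) (abs-entry 0<j j≤n))

  app-abs-range : ∀ {i} → 0 < i → i ≤ n → 0 < ∣ app w (+ i) ∣ × ∣ app w (+ i) ∣ ≤ n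
  app-abs-range 0<i i≤n with ∈-rangeFrom⁻ n (∈-resp-↭ (isPerm w) (entry⇒∈ (abs-entry 0<i i≤n)))
  ... | 0<c , c≤n = 0<c , ≤-pred c≤n

  app-abs-surjective : ∀ {c} → 0 < c → c ≤ n → ∃ λ i → 0 < i × i ≤ n × ∣ app w (+ i) ∣ ≡ c
  app-abs-surjective {c} 0<c c≤n
    with ∈⇒entry 1 (∈-resp-↭ (↭-sym (isPerm w)) (∈-rangeFrom⁺ n 0<c (s≤s c≤n)))
  ... | i , e with entry-map⁻ ∣_∣ values e
  ...   | y , e′ , refl = i , entry-≥ e′ , subst (i ≤_) length-values (≤-pred (entry-< e′)) , cong ∣_∣ (values-app e′)

  app-beyond : ∀ {i} → n < i → app w (+ i) ≡ + i
  app-beyond {suc i} (s≤s n≤i) rewrite at-beyond values i (subst (_≤ i) (sym length-values) n≤i) = refl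

  app-neg : ∀ x → app w (- x) ≡ - app w x
  app-neg (+ zero)  = refl
  app-neg (+ suc i) = refl
  app-neg -[1+ i ]  = sym (ℤₚ.neg-involutive (app w (+ suc i)))

  private
    app-abs : ∀ x → ∣ app w x ∣ ≡ ∣ app w (+ ∣ x ∣) ∣
    app-abs (+ i)    = refl
    app-abs -[1+ i ] = ℤₚ.∣-i∣≡∣i∣ (app w (+ suc i))

  app-zero : ∀ {x} → InR n x → app w x ≡ + 0 → x ≡ + 0
  app-zero {+ zero} _ _ = refl
  app-zero {+ suc i} xR eq with app-abs-range (s≤s z≤n) (inR⁻ (+ suc i) xR)
  ... | 0<w , _ = ⊥-elim (<-irrefl (sym (cong ∣_∣ eq)) 0<w)
  app-zero { -[1+ i ]} xR eq with app-abs-range (s≤s z≤n) (inR⁻ -[1+ i ] xR)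
  ... | 0<w , _ = ⊥-elim (<-irrefl (sym (trans (sym (app-abs -[1+ i ])) (cong ∣_∣ eq))) 0<w)

  -- Injectivity of the absolute values settles equal signs. For opposite signs it makes the
  -- positions opposite, so the value equals its own negative and vanishes, which happens only at 0.
  app-injective : ∀ {x y} → InR n x → InR n y → app w x ≡ app w y → x ≡ y
  app-injective {+ zero} xR yR eq = sym (app-zero yR (sym eq))
  app-injective {x} {+ zero} xR yR eq = app-zero xR eq
  app-injective {+ suc i} {+ suc j} xR yR eq =
    cong +_ (app-abs-injective (s≤s z≤n) (inR⁻ (+ suc i) xR) (s≤s z≤n) (inR⁻ (+ suc j) yR) (cong ∣_∣ eq))
  app-injective { -[1+ i ]} { -[1+ j ]} xR yR eq =
    cong neg (app-abs-injective (s≤s z≤n) (inR⁻ -[1+ i ] xR) (s≤s z≤n) (inR⁻ -[1+ j ] yR) (cong ∣_∣ (ℤₚ.neg-injective eq)))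
  app-injective {+ suc i} { -[1+ j ]} xR yR eq
    with app-abs-injective (s≤s z≤n) (inR⁻ (+ suc i) xR) (s≤s z≤n) (inR⁻ -[1+ j ] yR)
           (trans (cong ∣_∣ eq) (ℤₚ.∣-i∣≡∣i∣ (app w (+ suc j))))
  ... | refl with () ← app-zero xR (neg-fixed _ eq)
  app-injective { -[1+ i ]} {+ suc j} xR yR eq
    with app-abs-injective (s≤s z≤n) (inR⁻ -[1+ i ] xR) (s≤s z≤n) (inR⁻ (+ suc j) yR)
           (trans (sym (ℤₚ.∣-i∣≡∣i∣ (app w (+ suc i)))) (cong ∣_∣ eq))
  ... | refl with () ← app-zero yR (neg-fixed _ (sym eq))

  app-range : ∀ {x} → InR n x → InR n (app w x)
  app-range {x} xR = inR⁺ (app w x) (subst (_≤ n) (sym (app-abs x)) (bound ∣ x ∣ (inR⁻ x xR)))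
    where
    bound : ∀ i → i ≤ n → ∣ app w (+ i) ∣ ≤ n
    bound zero    _   = z≤n
    bound (suc i) i≤n = proj₂ (app-abs-range (s≤s z≤n) i≤n)

  app-surjective : ∀ {a} → InR n a → ∃ λ j → InR n j × app w j ≡ a
  app-surjective {a} aR with ∣ a ∣ ℕ.≟ 0
  ... | yes a≡0 = + 0 , subst (InR n) (ℤₚ.∣i∣≡0⇒i≡0 a≡0) aR , sym (ℤₚ.∣i∣≡0⇒i≡0 a≡0)
  ... | no  a≢0 with app-abs-surjective (ℕₚ.n≢0⇒n>0 a≢0) (inR⁻ a aR)
  ...   | i , _ , i≤n , eq with abs-cases (app w (+ i)) a eq
  ...     | inj₁ e = + i , inR⁺ (+ i) i≤n , e
  ...     | inj₂ e = - (+ i) , inR-neg (+ i) (inR⁺ (+ i) i≤n) , trans (app-neg (+ i)) (trans (cong -_ e) (ℤₚ.neg-involutive a))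

  oneLine-app : ∀ {N i y} → Entry 1 (oneLine w N) i y → app w (+ i) ≡ y
  oneLine-app {N} e with entry-map⁻ (λ i → app w (+ i)) (rangeFrom 1 N) e
  ... | c , e′ , refl = cong (λ i → app w (+ i)) (sym (entry-rangeFrom N e′))

  length-oneLine : ∀ N → length (oneLine w N) ≡ N
  length-oneLine N = trans (length-map _ (rangeFrom 1 N)) (length-rangeFrom 1 N)

  -- From w(τ) to avoidance of 2143

  Increasing : Set
  Increasing = ∀ {i j} → 0 < i → i < j → j ≤ n → + 0 ℤ.< app w (+ i) → + 0 ℤ.< app w (+ j) →
               app w (+ i) ℤ.< app w (+ j)

  AvoidsRight : Set
  AvoidsRight = ∀ {a b c d} → InR n a → a ℤ.< + b → 0 < b → b < c → c < d → d ≤ n →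
                app w (+ b) ℤ.< app w a → app w a ℤ.< app w (+ d) → app w (+ d) ℤ.< + 0 →
                ¬ app w (+ d) ℤ.< app w (+ c)

  -- Up to the symmetry x ↦ -x, a 2143 pattern contains a descent between
  -- two points of the quadrant x, w(x) > 0, or is of the form excluded by AvoidsRight.
  avoids : Increasing → AvoidsRight → VexillaryPerm n (app w)
  avoids incr right a b c d aR bR cR dR a<b b<c c<d (B<A , A<D , D<C) = cases
    where
    v = app w
    descent⁺ : ∀ {x y} → InR n y → + 0 ℤ.< x → x ℤ.< y → + 0 ℤ.< v x → + 0 ℤ.< v y → ¬ v y ℤ.< v x
    descent⁺ {+ i} {+ j} yR 0<x x<y 0<vx 0<vy vy<vx =
      ℤₚ.<-asym vy<vx (incr (ℤₚ.drop‿+<+ 0<x) (ℤₚ.drop‿+<+ x<y) (inR⁻ (+ j) yR) 0<vx 0<vy)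
    flip-v : ∀ {x y} → v x ℤ.< v y → v (- y) ℤ.< v (- x)
    flip-v {x} {y} lt = subst₂ ℤ._<_ (sym (app-neg y)) (sym (app-neg x)) (ℤₚ.neg-mono-< lt)
    descent⁻ : ∀ {x y} → InR n x → y ℤ.< + 0 → x ℤ.< y → v x ℤ.< + 0 → v y ℤ.< + 0 → ¬ v y ℤ.< v x
    descent⁻ {x} {y} xR y<0 x<y vx<0 vy<0 vy<vx =
      descent⁺ (inR-neg x xR) (ℤₚ.neg-mono-< y<0) (ℤₚ.neg-mono-< x<y) (flip-v {y} {+ 0} vy<0) (flip-v {x} {+ 0} vx<0) (flip-v {y} {x} vy<vx)
    pattern⁺ : ∀ {a b c d} → InR n a → InR n d → a ℤ.< b → + 0 ℤ.< b → b ℤ.< c → c ℤ.< d →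
               v b ℤ.< v a → v a ℤ.< v d → v d ℤ.< + 0 → ¬ v d ℤ.< v c
    pattern⁺ {a} {+ b} {+ c} {+ d} aR dR a<b 0<b b<c c<d =
      right aR a<b (ℤₚ.drop‿+<+ 0<b) (ℤₚ.drop‿+<+ b<c) (ℤₚ.drop‿+<+ c<d) (inR⁻ (+ d) dR)
    cases : ⊥
    cases with ℤₚ.<-cmp (v d) (+ 0)
    cases | tri< D<0 _ _ with ℤₚ.<-cmp b (+ 0)
    ... | tri< b<0 _ _  = descent⁻ aR b<0 a<b (ℤₚ.<-trans A<D D<0) (ℤₚ.<-trans B<A (ℤₚ.<-trans A<D D<0)) B<A
    ... | tri≈ _ refl _ = ℤₚ.<-asym D<0 (ℤₚ.<-trans B<A A<D)
    ... | tri> _ _ 0<b  = pattern⁺ aR dR a<b 0<b b<c c<d B<A A<D D<0 D<C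
    cases | tri≈ _ D≡0 _ with refl ← app-zero dR D≡0 =
      descent⁻ aR (ℤₚ.<-trans b<c c<d) a<b A<D (ℤₚ.<-trans B<A A<D) B<A
    cases | tri> _ _ 0<D with ℤₚ.<-cmp c (+ 0)
    ... | tri> _ _ 0<c  = descent⁺ dR 0<c c<d (ℤₚ.<-trans 0<D D<C) 0<D D<C
    ... | tri≈ _ refl _ = ℤₚ.<-asym 0<D D<C
    ... | tri< c<0 _ _ with ℤₚ.<-cmp (v a) (+ 0)
    ...   | tri< A<0 _ _ = descent⁻ aR (ℤₚ.<-trans b<c c<0) a<b A<0 (ℤₚ.<-trans B<A A<0) B<A
    ...   | tri≈ _ A≡0 _ with refl ← app-zero aR A≡0 = ℤₚ.<-asym c<0 (ℤₚ.<-trans a<b b<c)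
    -- Reflection turns the positions `a`, `b`, `c`, `d` into `- d`, `- c`, `- b`, `- a`, again a
    -- 2143 pattern, now with its last three positions positive and its last value negative.
    ...   | tri> _ _ 0<A =
      pattern⁺ (inR-neg d dR) (inR-neg a aR) (ℤₚ.neg-mono-< c<d) (ℤₚ.neg-mono-< c<0) (ℤₚ.neg-mono-< b<c)
        (ℤₚ.neg-mono-< a<b) (flip-v {d} {c} D<C) (flip-v {a} {d} A<D) (flip-v {+ 0} {a} 0<A) (flip-v {b} {a} B<A)

  vexillary⇒avoiding : Vexillary w → VexillaryPerm n (app w)
  vexillary⇒avoiding (τ , (pos , lnk) , N , n≤N , eq) with bind⁻ (blocks 0 τ (replicate N nothing) []) eq
  ... | (ss , used) , eq₁ , eq₂ = avoids increasing right
    where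
    good : Good ss
    good = blocks-good 0 τ (replicate N nothing) []
      (record { negative = λ e → ⊥-elim (vacant e) ; injective = λ e → ⊥-elim (vacant e) ; pair = λ e → ⊥-elim (vacant e) })
      (record { sound = λ () ; complete = λ e → ⊥-elim (vacant e) })
      pos lnk (λ _ → inj₁ λ e → vacant e) eq₁
    open Good good
    us : List ℕ
    us = filter (λ c → ¬? (c ∈? used)) (rangeFrom 1 (N + length used))
    f : Filled us ss (oneLine w N)
    f = fill⇒Filled us ss eq₂
    entry : ∀ {i} → 0 < i → i ≤ n → ∃ (Entry 1 ss i)
    entry {i} 0<i i≤n = entry-total ss 0<i
      (s≤s (≤-trans i≤n (≤-trans n≤N (≤-reflexive (sym (trans (filled-length f) (length-oneLine N)))))))
    pt-app : ∀ {i c} → Pt ss i c → app w (+ i) ≡ neg c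
    pt-app P = oneLine-app {N} (filled-just f P)
    positive : ∀ {i} → 0 < i → i ≤ n → + 0 ℤ.< app w (+ i) → Entry 1 ss i nothing
    positive 0<i i≤n 0<v with entry 0<i i≤n
    ... | nothing , e = e
    ... | just y  , e with negative e
    ...   | c , 0<c , refl = ⊥-elim (ℤₚ.<-asym 0<v (subst (ℤ._< + 0) (sym (pt-app e)) (neg-mono 0<c)))
    negative-pt : ∀ {i} → 0 < i → i ≤ n → app w (+ i) ℤ.< + 0 → ∃ λ c → Pt ss i c
    negative-pt 0<i i≤n v<0 with entry 0<i i≤n
    ... | just y , e with negative e
    ...   | c , _ , refl = c , e
    negative-pt 0<i i≤n v<0 | nothing , e with filled-nothing f e
    ... | u , _ , e′ with ℤ.+<+ () ← subst (ℤ._< + 0) (oneLine-app {N} e′) v<0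
    increasing : Increasing
    increasing 0<i i<j j≤n 0<vi 0<vj =
      filled-monotone (filtered-sorted 1 (N + length used) used) f ei ej i<j (at-entry ei) (at-entry ej)
      where
      ei = positive 0<i (≤-trans (<⇒≤ i<j) j≤n) 0<vi
      ej = positive (<-trans 0<i i<j) j≤n 0<vj
      at-entry : ∀ {i} → Entry 1 ss i nothing → Entry 1 (oneLine w N) i (app w (+ i))
      at-entry e with filled-nothing f e
      ... | u , _ , e′ = subst (Entry 1 (oneLine w N) _) (sym (oneLine-app {N} e′)) e′
    right : AvoidsRight
    right {a} {b} {c} {d} aR a<b 0<b b<c c<d d≤n B<A A<D D<0 D<C
      with negative-pt 0<b (≤-trans (<⇒≤ (<-trans b<c c<d)) d≤n) (ℤₚ.<-trans B<A (ℤₚ.<-trans A<D D<0))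
         | negative-pt (<-trans 0<b (<-trans b<c c<d)) d≤n D<0
    ... | C , P | D , Q with pair P Q (<-trans b<c c<d)
                               (neg-cancel (subst₂ ℤ._<_ (pt-app P) (pt-app Q) (ℤₚ.<-trans B<A A<D)))
    ...   | inj₁ filled = let E , R , D<E = filled c b<c c<d in
              ℤₚ.<-asym D<C (subst₂ ℤ._<_ (sym (pt-app R)) (sym (pt-app Q)) (neg-mono D<E))
    -- The value at `a` is -x with D < x < C, so `between` finds it also at a position to the right
    -- of `b`; injectivity then contradicts `a < + b`.
    ...   | inj₂ between = value (app w a) refl
      where
      value : ∀ y → app w a ≡ y → ⊥
      value (+ x) eq with ℤ.+<+ () ← subst (ℤ._< + 0) eq (ℤₚ.<-trans A<D D<0)
      value -[1+ x ] eq
        with between (suc x) (neg-cancel (subst₂ ℤ._<_ eq (pt-app Q) A<D)) (neg-cancel (subst₂ ℤ._<_ (pt-app P) eq B<A))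
      ... | i , R , b<i with i ℕ.≤? n
      -- The list has N positions, possibly more than n; those beyond n are fixed and carry positive
      -- values.
      ...   | no i≰n with () ← trans (sym (app-beyond (ℕₚ.≰⇒> i≰n))) (pt-app R)
      ...   | yes i≤n with refl ← app-injective aR (inR⁺ (+ i) i≤n) (trans eq (sym (pt-app R))) =
                <-irrefl refl (<-trans b<i (ℤₚ.drop‿+<+ a<b))

-- Reconstruction of a triple

-- A bounded search in place of excluded middle. With a violation as `P` and the wanted property as
-- `Q`, `good-pair` obtains the property throughout or a concrete violation; `least` uses that the
-- index found is the first one.
first : ∀ {P Q : ℕ → Set} → (∀ i → P i ⊎ Q i) → ∀ n →
        (∀ i → i < n → Q i) ⊎ (∃ λ i → i < n × P i × (∀ j → j < i → Q j))
first f zero = inj₁ λ _ ()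
first {P} {Q} f (suc n) with first f n
... | inj₂ (i , i<n , Pi , below) = inj₂ (i , ℕₚ.m<n⇒m<1+n i<n , Pi , below)
... | inj₁ none with f n
...   | inj₁ Pn = inj₂ (n , ≤-refl , Pn , none)
...   | inj₂ Qn = inj₁ λ i i<1+n → [ none i , (λ { refl → Qn }) ]′ (ℕₚ.m≤n⇒m<n∨m≡n (≤-pred i<1+n))

least : ∀ {P : ℕ → Set} → (∀ i → Dec (P i)) → ∀ {m} → P m → ∃ λ i → P i × (∀ {j} → P j → i ≤ j)
least P? {m} Pm with first (λ i → toSum (P? i)) (suc m)
... | inj₁ none = ⊥-elim (none m ≤-refl Pm)
... | inj₂ (i , _ , Pi , below) = i , Pi , λ {j} Pj → ℕₚ.≮⇒≥ λ j<i → below j j<i Pj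

data Erased : ℕ → ℕ → ℤ → List (Maybe ℤ) → List (Maybe ℤ) → Set where
  here  : ∀ {i y ss} → Erased i i y (just y ∷ ss) (nothing ∷ ss)
  there : ∀ {i j y m ss ss₀} → Erased (suc i) j y ss ss₀ → Erased i j y (m ∷ ss) (m ∷ ss₀)

erase : ∀ {i j y ss} → Entry i ss j (just y) → ∃ (Erased i j y ss)
erase here      = _ , here
erase (there e) = let ss₀ , r = erase e in _ , there r

erased-≥ : ∀ {i j y ss ss₀} → Erased i j y ss ss₀ → i ≤ j
erased-≥ here      = ≤-refl
erased-≥ (there r) = <⇒≤ (erased-≥ r)

erased-⊆ : ∀ {i j y ss ss₀ k z} → Erased i j y ss ss₀ → Entry i ss₀ k (just z) → Entry i ss k (just z) × k ≢ j
erased-⊆ here      (there e) = there e , λ { refl → <-irrefl refl (entry-≥ e) }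
erased-⊆ (there r) here      = here , λ { refl → <-irrefl refl (erased-≥ r) }
erased-⊆ (there r) (there e) = let e′ , k≢j = erased-⊆ r e in there e′ , k≢j

erased-⊇ : ∀ {i j y ss ss₀ k z} → Erased i j y ss ss₀ → Entry i ss k (just z) → k ≢ j → Entry i ss₀ k (just z)
erased-⊇ here      here      k≢j = ⊥-elim (k≢j refl)
erased-⊇ here      (there e) k≢j = there e
erased-⊇ (there r) here      k≢j = here
erased-⊇ (there r) (there e) k≢j = there (erased-⊇ r e k≢j)

erased-length : ∀ {i j y ss ss₀} → Erased i j y ss ss₀ → length ss₀ ≡ length ss
erased-length here      = refl
erased-length (there r) = cong suc (erased-length r)

-- After the erasure `j` is the first vacant position from `p` on, so the placement of the single
-- value puts it back there.
erased-placed : ∀ {i j p y ss ss₀} → Erased i j y ss ss₀ → p ≤ j →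
                (∀ k → i ≤ k → p ≤ k → k < j → ∃ λ z → Entry i ss k (just z)) → Placed i p (y ∷ []) ss₀ ss
erased-placed here p≤j occupied = put p≤j done
erased-placed {i} {j} {p} (there {m = m} {ss = ss} r) p≤j occupied with m
... | just _  = skip (erased-placed r p≤j occupied′)
  where
  occupied′ : ∀ k → suc i ≤ k → p ≤ k → k < j → ∃ λ z → Entry (suc i) ss k (just z)
  occupied′ k i<k p≤k k<j with occupied k (<⇒≤ i<k) p≤k k<j
  ... | z , here    = ⊥-elim (<-irrefl refl i<k)
  ... | z , there e = z , e
... | nothing = low (ℕₚ.≰⇒> λ p≤i → first-vacant p≤i (occupied i ≤-refl p≤i (erased-≥ r)))
                    (erased-placed r p≤j occupied′)
  where
  first-vacant : p ≤ i → ¬ ∃ λ z → Entry i (nothing ∷ ss) i (just z)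
  first-vacant _ (z , there e) = <-irrefl refl (entry-≥ e)
  occupied′ : ∀ k → suc i ≤ k → p ≤ k → k < j → ∃ λ z → Entry (suc i) ss k (just z)
  occupied′ k i<k p≤k k<j with occupied k (<⇒≤ i<k) p≤k k<j
  ... | z , there e = z , e

count : List (Maybe ℤ) → ℕ
count []             = 0
count (nothing ∷ ss) = count ss
count (just _ ∷ ss)  = suc (count ss)

erased-count : ∀ {i j y ss ss₀} → Erased i j y ss ss₀ → count ss ≡ suc (count ss₀)
erased-count here                    = refl
erased-count (there {m = nothing} r) = erased-count r
erased-count (there {m = just _} r)  = cong suc (erased-count r)

count-zero : ∀ ss → count ss ≡ 0 → ss ≡ replicate (length ss) nothing
count-zero []             eq = refl
count-zero (nothing ∷ ss) eq = cong (nothing ∷_) (count-zero ss eq)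

count-suc : ∀ i ss {k} → count ss ≡ suc k → ∃₂ λ j y → Entry i ss j (just y)
count-suc i (nothing ∷ ss) eq = let j , y , e = count-suc (suc i) ss eq in j , y , there e
count-suc i (just y ∷ ss)  eq = i , y , here

-- The values from `q` up to but excluding `c` are used, so `filter` drops them and `c` comes first.
-- There are at most `length used` of them, so the interval scanned, of length `1 + length used`,
-- reaches `c`.
smallestUnused-one : ∀ {q c used} → q ≤ c → c ∉ used → (∀ x → q ≤ x → x < c → x ∈ used) →
                     smallestUnused 1 q used ≡ c ∷ []
smallestUnused-one {q₀} {c} {used} q₀≤c c∉ below = scan q₀ (suc (length used)) q₀≤c ≤-refl enough
  where
  P? : ∀ c → Dec (c ∉ used)
  P? c = ¬? (c ∈? used)
  scan : ∀ q l → q ≤ c → q₀ ≤ q → c < q + l → take 1 (filter P? (rangeFrom q l)) ≡ c ∷ []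
  scan q zero q≤c _ c< = ⊥-elim (<-irrefl refl (<-≤-trans (subst (c <_) (+-identityʳ q) c<) q≤c))
  scan q (suc l) q≤c q₀≤q c< with ℕₚ.m≤n⇒m<n∨m≡n q≤c
  ... | inj₂ refl = cong (take 1) (filter-accept P? {xs = rangeFrom (suc q) l} c∉)
  ... | inj₁ q<c  = trans (cong (take 1) (filter-reject P? {xs = rangeFrom (suc q) l} (λ q∉ → q∉ (below q q₀≤q q<c))))
                          (scan (suc q) l q<c (≤-trans q₀≤q (n≤1+n q)) (subst (c <_) (+-suc q l) c<))
  gap : length (rangeFrom q₀ (c ∸ q₀)) ≤ length used
  gap = unique-⊆-length (sorted⇒unique (rangeFrom-sorted q₀ (c ∸ q₀)))
          λ x∈ → let q≤x , x< = ∈-rangeFrom⁻ (c ∸ q₀) x∈ in below _ q≤x (subst (_ <_) (ℕₚ.m+[n∸m]≡n q₀≤c) x<)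
  enough : c < q₀ + suc (length used)
  enough = subst₂ _<_ (ℕₚ.m+[n∸m]≡n q₀≤c) (sym (+-suc q₀ _))
             (s≤s (ℕₚ.+-monoʳ-≤ q₀ (subst (_≤ length used) (length-rangeFrom q₀ (c ∸ q₀)) gap)))

lastK : ℕ → Triple → ℕ
lastK m []            = m
lastK m ((k , _) ∷ τ) = lastK k τ

lastK-∷ʳ : ∀ m τ k {pq} → lastK m (τ ++ (k , pq) ∷ []) ≡ k
lastK-∷ʳ m []            k = refl
lastK-∷ʳ m ((l , _) ∷ τ) k = lastK-∷ʳ l τ k

blocks-∷ʳ : ∀ m τ {ss used ss₁ used₁ k p q} → blocks m τ ss used ≡ just (ss₁ , used₁) →
            blocks m (τ ++ (k , p , q) ∷ []) ss used ≡ blocks (lastK m τ) ((k , p , q) ∷ []) ss₁ used₁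
blocks-∷ʳ m [] refl = refl
blocks-∷ʳ m ((k , p , q) ∷ τ) {ss} {used} eq
  with place 1 p (reverse (map neg (smallestUnused (k ∸ m) q used))) ss
... | just ss′ = blocks-∷ʳ k τ eq

linked-∷ʳ : ∀ {R : A → A → Set} xs {x y} → Linked R (xs ++ x ∷ []) → R x y → Linked R ((xs ++ x ∷ []) ++ y ∷ [])
linked-∷ʳ []            [-]       Rxy = Rxy ∷ [-]
linked-∷ʳ (z ∷ [])      (r ∷ lnk) Rxy = r ∷ linked-∷ʳ [] lnk Rxy
linked-∷ʳ (z ∷ z′ ∷ xs) (r ∷ lnk) Rxy = r ∷ linked-∷ʳ (z′ ∷ xs) lnk Rxy

occupied? : ∀ {ss} → Good ss → ∀ i → Dec (∃ λ c → Pt ss i c)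
occupied? {ss} good i with 0 ℕ.<? i | i ℕ.<? suc (length ss)
... | no i≤0  | _      = no λ { (_ , e) → i≤0 (entry-≥ e) }
... | yes _   | no i≥  = no λ { (_ , e) → i≥ (entry-< e) }
... | yes 0<i | yes i< with entry-total ss 0<i i<
...   | nothing , e = no λ { (_ , e′) → nothing≢just (entry-functional e e′) }
  where
  nothing≢just : ∀ {x : ℤ} → nothing ≢ just x
  nothing≢just ()
...   | just y  , e with Good.negative good e
...     | c , _ , refl = yes (c , e)

used? : ∀ ss c → Dec (∃ λ i → Pt ss i c)
used? ss c = map′ (∈⇒entry 1) (λ { (_ , e) → entry⇒∈ e }) (just (neg c) ∈ₛ? ss)

-- The pair condition, applied to the leftmost point and to the point of
-- least value, makes one of the two the last one to be placed.
removable : ∀ {ss p q a b} → Good ss → Bounded ss p q → Pt ss p a → Pt ss b q →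
            ∃₂ λ j c → Pt ss j c × (∀ i → p ≤ i → i < j → ∃ λ E → Pt ss i E) ×
                       (∀ x → q ≤ x → x < c → ∃ λ i → Pt ss i x) × (j ≡ p ⊎ c ≡ q)
removable {ss} {p} {q} {a} {b} good bounded P Q with ℕₚ.m≤n⇒m<n∨m≡n (proj₁ (bounded Q))
... | inj₂ refl = p , q , Q , (λ i p≤i i<p → ⊥-elim (<-irrefl refl (≤-<-trans p≤i i<p)))
                            , (λ x q≤x x<q → ⊥-elim (<-irrefl refl (≤-<-trans q≤x x<q))) , inj₁ refl
... | inj₁ p<b with ℕₚ.m≤n⇒m<n∨m≡n (proj₂ (bounded P))
...   | inj₂ refl = ⊥-elim (<-irrefl (Good.injective good P Q) p<b)
...   | inj₁ q<a with Good.pair good P Q p<b q<a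
...     | inj₁ filled = b , q , Q , positions , (λ x q≤x x<q → ⊥-elim (<-irrefl refl (≤-<-trans q≤x x<q))) , inj₂ refl
  where
  positions : ∀ i → p ≤ i → i < b → ∃ λ E → Pt ss i E
  positions i p≤i i<b with ℕₚ.m≤n⇒m<n∨m≡n p≤i
  ... | inj₂ refl = a , P
  ... | inj₁ p<i  = let E , R , _ = filled i p<i i<b in E , R
...     | inj₂ used = p , a , P , (λ i p≤i i<p → ⊥-elim (<-irrefl refl (≤-<-trans p≤i i<p))) , values , inj₁ refl
  where
  values : ∀ x → q ≤ x → x < a → ∃ λ i → Pt ss i x
  values x q≤x x<a with ℕₚ.m≤n⇒m<n∨m≡n q≤x
  ... | inj₂ refl = b , Q
  ... | inj₁ q<x  = let i , R , _ = used x q<x x<a in i , R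

-- The points that witness `pair` lie strictly to the right of `b ≥ p` and have values strictly
-- above `D ≥ q`. The erased point has position `p` or value `q`, so it is none of them.
erased-good : ∀ {ss ss₀ p q j c} → Good ss → Bounded ss p q → Pt ss j c → Erased 1 j (neg c) ss ss₀ →
              j ≡ p ⊎ c ≡ q → Good ss₀
erased-good {ss} {ss₀} {p} {q} {j} {c} good bounded J r extreme = record
  { negative  = λ e → negative (proj₁ (erased-⊆ r e))
  ; injective = λ P Q → injective (proj₁ (erased-⊆ r P)) (proj₁ (erased-⊆ r Q))
  ; pair      = pair₀ }
  where
  open Good good
  kept : ∀ {b d C D i E} → Pt ss b C → Pt ss d D → Pt ss i E → b < i → D < E → Pt ss₀ i E
  kept P Q R b<i D<E = erased-⊇ r R λ { refl → [ (λ { refl → <-irrefl refl (≤-<-trans (proj₁ (bounded P)) b<i) })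
    , (λ { refl → <-irrefl refl (≤-<-trans (proj₂ (bounded Q)) (subst (_ <_) (pt-functional R J) D<E)) }) ]′ extreme }
  pair₀ : ∀ {b d C D} → Pt ss₀ b C → Pt ss₀ d D → b < d → D < C → FilledBetween ss₀ b d D ⊎ UsedBetween ss₀ D C b
  pair₀ P₀ Q₀ b<d D<C with erased-⊆ r P₀ | erased-⊆ r Q₀
  ... | P , _ | Q , _ with pair P Q b<d D<C
  ...   | inj₁ f = inj₁ λ i b<i i<d → let E , R , D<E = f i b<i i<d in E , kept P Q R b<i D<E , D<E
  ...   | inj₂ u = inj₂ λ x D<x x<C → let i , R , b<i = u x D<x x<C in i , kept P Q R b<i D<x , b<i

-- In `stage` all blocks have size one, so `k` counts both the columns and the points. After an
-- earlier column, a further one needs `p` or `q` to decrease strictly; `extends` gets this from the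
-- absence of points in the new position `p` or with the new value `q`.
record Stage (ss : List (Maybe ℤ)) (k : ℕ) : Set where
  field
    τ        : Triple
    used     : List ℕ
    isTriple : IsTriple τ
    builds   : blocks 0 τ (replicate (length ss) nothing) [] ≡ just (ss , used)
    uses     : Uses ss used
    last     : lastK 0 τ ≡ k
    extends  : ∀ {p q} → 0 < p → 0 < q → Bounded ss p q →
               (∀ {c} → ¬ Pt ss p c) ⊎ (∀ {i} → ¬ Pt ss i q) → IsTriple (τ ++ (suc k , p , q) ∷ [])

stage : ∀ k ss → Good ss → count ss ≡ k → Stage ss k
stage zero ss good eq = record
  { τ        = []
  ; used     = []
  ; isTriple = [] , []
  ; builds   = cong (λ ss → just (ss , [])) (sym (count-zero ss eq))
  ; uses     = record { sound = λ () ; complete = λ {i} {c} P → ⊥-elim (vacant (subst (λ ss → Pt ss i c) (count-zero ss eq) P)) }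
  ; last     = refl
  ; extends  = λ 0<p 0<q _ _ → (s≤s z≤n , 0<p , 0<q) ∷ [] , [-]
  }
stage (suc k) ss good eq
  with count-suc 1 ss eq
... | i₀ , y₀ , e₀ with Good.negative good e₀
... | c₀ , _ , refl with least (occupied? good) (c₀ , e₀) | least (used? ss) (i₀ , e₀)
... | p , (a , P) , p≤ | q , (b , Q) , q≤ with removable {p = p} {q} good (λ {i} {c} R → p≤ (c , R) , q≤ (i , R)) P Q
... | j , c , J , positions , values , extreme with erase J
... | ss₀ , r = record
  { τ        = τ ++ col ∷ []
  ; used     = used ++ c ∷ []
  ; isTriple = isTriple′
  ; builds   = trans (cong (λ l → blocks 0 (τ ++ col ∷ []) (replicate l nothing) []) (sym (erased-length r)))
                     (trans (blocks-∷ʳ 0 τ builds) placing)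
  ; uses     = record { sound = sound′ ; complete = complete′ }
  ; last     = lastK-∷ʳ 0 τ (suc k)
  ; extends  = extends′
  }
  where
  col : ℕ × ℕ × ℕ
  col = suc k , p , q
  bounded : Bounded ss p q
  bounded {i} {c} R = p≤ (c , R) , q≤ (i , R)
  open Good good
  open Stage (stage k ss₀ (erased-good good bounded J r extreme) (ℕₚ.suc-injective (trans (sym (erased-count r)) eq)))
  open Uses uses
  0<q : 0 < q
  0<q with negative Q
  ... | _ , 0<c , eq′ = subst (0 <_) (sym (neg-injective eq′)) 0<c
  isTriple′ : IsTriple (τ ++ col ∷ [])
  -- Whichever coordinate of the erased point is extreme, no remaining point shares it, and this is
  -- the freeness that `extends` asks for.
  isTriple′ = extends (entry-≥ P) 0<q (λ R → bounded (proj₁ (erased-⊆ r R))) (fresh extreme)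
    where
    fresh : j ≡ p ⊎ c ≡ q → (∀ {c} → ¬ Pt ss₀ p c) ⊎ (∀ {i} → ¬ Pt ss₀ i q)
    fresh (inj₁ refl) = inj₁ λ R → proj₂ (erased-⊆ r R) refl
    fresh (inj₂ refl) = inj₂ λ R → proj₂ (erased-⊆ r R) (injective (proj₁ (erased-⊆ r R)) J)
  next : smallestUnused 1 q used ≡ c ∷ []
  next = smallestUnused-one (proj₂ (bounded J))
    (λ c∈ → let R , i≢j = erased-⊆ r (proj₂ (sound c∈)) in i≢j (injective R J))
    (λ x q≤x x<c → let i , R = values x q≤x x<c in
      complete (erased-⊇ r R λ { refl → <-irrefl (pt-functional R J) x<c }))
  placing : blocks (lastK 0 τ) (col ∷ []) ss₀ used ≡ just (ss , used ++ c ∷ [])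
  placing rewrite last | ℕₚ.m+n∸n≡m 1 k | next
    | Placed⇒place (erased-placed r (proj₁ (bounded J)) (λ i _ p≤i i<j → let E , R = positions i p≤i i<j in neg E , R)) = refl
  sound′ : ∀ {x} → x ∈ used ++ c ∷ [] → ∃ λ i → Pt ss i x
  sound′ x∈ with ∈-++⁻ used x∈
  ... | inj₁ x∈used      = let i , R = sound x∈used in i , proj₁ (erased-⊆ r R)
  ... | inj₂ (here refl) = j , J
  complete′ : ∀ {i x} → Pt ss i x → x ∈ used ++ c ∷ []
  complete′ {i} R with i ℕ.≟ j
  ... | yes refl = ∈-++⁺ʳ used (here (pt-functional R J))
  ... | no  i≢j  = ∈-++⁺ˡ (complete (erased-⊇ r R i≢j))
  extends′ : ∀ {p₁ q₁} → 0 < p₁ → 0 < q₁ → Bounded ss p₁ q₁ → (∀ {c} → ¬ Pt ss p₁ c) ⊎ (∀ {i} → ¬ Pt ss i q₁) →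
             IsTriple ((τ ++ col ∷ []) ++ (suc (suc k) , p₁ , q₁) ∷ [])
  extends′ {p₁} {q₁} 0<p₁ 0<q₁ bounded₁ free =
    Allₚ.++⁺ (proj₁ isTriple′) ((s≤s z≤n , 0<p₁ , 0<q₁) ∷ []) ,
    linked-∷ʳ τ (proj₂ isTriple′)
      (≤-refl , p₁≤p , q₁≤q , subst (_≤ (p ∸ p₁) + (q ∸ q₁)) (sym (ℕₚ.m+n∸n≡m 1 k)) (increment free))
    where
    p₁≤p : p₁ ≤ p
    p₁≤p = proj₁ (bounded₁ P)
    q₁≤q : q₁ ≤ q
    q₁≤q = proj₂ (bounded₁ Q)
    -- The points `P` and `Q` attain `p` and `q`, so equality in the free coordinate is impossible
    -- and one of the two differences is at least 1.
    increment : (∀ {c} → ¬ Pt ss p₁ c) ⊎ (∀ {i} → ¬ Pt ss i q₁) → 1 ≤ (p ∸ p₁) + (q ∸ q₁)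
    increment (inj₁ none) = ≤-trans (ℕₚ.m<n⇒0<n∸m (≤∧≢⇒< p₁≤p λ { refl → none P })) (ℕₚ.m≤m+n _ _)
    increment (inj₂ none) = ≤-trans (ℕₚ.m<n⇒0<n∸m (≤∧≢⇒< q₁≤q λ { refl → none Q })) (ℕₚ.m≤n+m _ _)

-- From one-line notation to a triple

negOnly : ℤ → Maybe ℤ
negOnly (+ _)      = nothing
negOnly -[1+ c ]   = just -[1+ c ]

positives : List ℤ → List ℕ
positives []             = []
positives (+ c ∷ l)      = c ∷ positives l
positives (-[1+ _ ] ∷ l) = positives l

fill-positives : ∀ l rest → fill (positives l ++ rest) (map negOnly l) ≡ just l
fill-positives []             rest = refl
fill-positives (+ c ∷ l)      rest rewrite fill-positives l rest = refl
fill-positives (-[1+ _ ] ∷ l) rest rewrite fill-positives l rest = refl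

∈-positives⁻ : ∀ i l {c} → c ∈ positives l → ∃ λ j → Entry i l j (+ c)
∈-positives⁻ i (+ c ∷ l)      (here refl) = i , here
∈-positives⁻ i (+ c ∷ l)      (there c∈)  = let j , e = ∈-positives⁻ (suc i) l c∈ in j , there e
∈-positives⁻ i (-[1+ _ ] ∷ l) c∈          = let j , e = ∈-positives⁻ (suc i) l c∈ in j , there e

∈-positives⁺ : ∀ {i j c} l → Entry i l j (+ c) → c ∈ positives l
∈-positives⁺ (+ c ∷ l)      here      = here refl
∈-positives⁺ (+ c ∷ l)      (there e) = there (∈-positives⁺ l e)
∈-positives⁺ (-[1+ _ ] ∷ l) (there e) = ∈-positives⁺ l e

positives-sorted : ∀ i l → (∀ {j k c d} → Entry i l j (+ c) → Entry i l k (+ d) → j < k → c < d) →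
                   AllPairs _<_ (positives l)
positives-sorted i []             mono = []
positives-sorted i (-[1+ _ ] ∷ l) mono = positives-sorted (suc i) l λ e e′ → mono (there e) (there e′)
positives-sorted i (+ c ∷ l)      mono =
  All.tabulate (λ d∈ → let k , e = ∈-positives⁻ (suc i) l d∈ in mono here (there e) (entry-≥ e)) ∷
  positives-sorted (suc i) l λ e e′ → mono (there e) (there e′)

module _ {n : ℕ} (w : SignedPerm n) (vex : VexillaryPerm n (app w)) where

  private
    v : ℤ → ℤ
    v = app w

    ss : List (Maybe ℤ)
    ss = map negOnly (oneLine w n)

    line-bounds : ∀ {i y} → Entry 1 (oneLine w n) i y → 0 < i × i ≤ n
    line-bounds e = entry-≥ e , subst (_ ≤_) (length-oneLine w n) (≤-pred (entry-< e))

    line-R : ∀ {i y} → Entry 1 (oneLine w n) i y → InR n (+ i)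
    line-R e = inR⁺ _ (proj₂ (line-bounds e))

    line-entry : ∀ {i} → 0 < i → i ≤ n → Entry 1 (oneLine w n) i (v (+ i))
    line-entry {i} 0<i i≤n with entry-total (oneLine w n) 0<i (s≤s (subst (i ≤_) (sym (length-oneLine w n)) i≤n))
    ... | y , e = subst (Entry 1 _ i) (sym (oneLine-app w {n} e)) e

    ss-entry⁻ : ∀ {i y} → Entry 1 ss i (just y) → 0 < i × i ≤ n × v (+ i) ≡ y × ∃ λ c → y ≡ -[1+ c ]
    ss-entry⁻ e with entry-map⁻ negOnly (oneLine w n) e
    ... | -[1+ c ] , e′ , refl = proj₁ (line-bounds e′) , proj₂ (line-bounds e′) , oneLine-app w {n} e′ , c , refl

    ss-entry⁺ : ∀ {i c} → 0 < i → i ≤ n → 0 < c → v (+ i) ≡ neg c → Pt ss i c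
    ss-entry⁺ {i} {suc c} 0<i i≤n _ eq =
      entry-map⁺ negOnly (subst (Entry 1 (oneLine w n) i) eq (line-entry 0<i i≤n))

    pt-app : ∀ {i c} → Pt ss i c → v (+ i) ≡ neg c
    pt-app P = proj₁ (proj₂ (proj₂ (ss-entry⁻ P)))

    pt-R : ∀ {i c} → Pt ss i c → InR n (+ i)
    pt-R P = inR⁺ _ (proj₁ (proj₂ (ss-entry⁻ P)))

    -- One search looks for a position `c` between `b` and `d` with a value above that of `d`, the
    -- other for a value -x between -C and -D that occurs to the left of `b`. A search that fails
    -- gives one of the alternatives; if both succeed, the positions found form a 2143 pattern with
    -- `b` and `d`.
    good-pair : ∀ {b d C D} → Pt ss b C → Pt ss d D → b < d → D < C → FilledBetween ss b d D ⊎ UsedBetween ss D C b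
    good-pair {b} {d} {C} {D} P Q b<d D<C with first positions d | first values C
      where
      positions : ∀ i → (b < i × i < d × v (+ d) ℤ.< v (+ i)) ⊎ (b < i → i < d → ∃ λ E → Pt ss i E × D < E)
      positions i with b ℕ.<? i | i ℕ.<? d
      ... | no b≮i  | _       = inj₂ λ b<i → ⊥-elim (b≮i b<i)
      ... | yes _   | no i≮d  = inj₂ λ _ i<d → ⊥-elim (i≮d i<d)
      ... | yes b<i | yes i<d with ℤₚ.<-cmp (v (+ i)) (v (+ d))
      ...   | tri> _ _ vd<vi = inj₁ (b<i , i<d , vd<vi)
      ...   | tri≈ _ eq _ = ⊥-elim (<-irrefl (ℤₚ.+-injective (app-injective w (inR⁺ (+ i) i≤n) (pt-R Q) eq)) i<d)
        where
        i≤n : i ≤ n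
        i≤n = ≤-trans (<⇒≤ i<d) (inR⁻ (+ d) (pt-R Q))
      ...   | tri< vi<vd _ _ = inj₂ λ _ _ → value (v (+ i)) refl
        where
        vi<-D : v (+ i) ℤ.< neg D
        vi<-D = subst (v (+ i) ℤ.<_) (pt-app Q) vi<vd
        value : ∀ y → v (+ i) ≡ y → ∃ λ E → Pt ss i E × D < E
        value (+ y) eq = ⊥-elim (ℤₚ.<-irrefl refl (ℤₚ.≤-<-trans (ℤₚ.neg-≤-pos {D} {y}) (subst (ℤ._< neg D) eq vi<-D)))
        value -[1+ y ] eq = suc y , ss-entry⁺ (≤-<-trans z≤n b<i) (≤-trans (<⇒≤ i<d) (inR⁻ (+ d) (pt-R Q))) (s≤s z≤n) eq
                                  , neg-cancel (subst (ℤ._< neg D) eq vi<-D)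
      values : ∀ x → (D < x × x < C × ∃ λ a → InR n a × a ℤ.< + b × v a ≡ neg x) ⊎
                     (D < x → x < C → ∃ λ i → Pt ss i x × b < i)
      values x with D ℕ.<? x | x ℕ.<? C
      ... | no D≮x  | _       = inj₂ λ D<x → ⊥-elim (D≮x D<x)
      ... | yes _   | no x≮C  = inj₂ λ _ x<C → ⊥-elim (x≮C x<C)
      ... | yes D<x | yes x<C with app-surjective w {neg x} (inR-neg (+ x) (inR⁺ (+ x) x≤n))
        where
        C≤n : C ≤ n
        C≤n = subst (_≤ n) (trans (cong ∣_∣ (pt-app P)) (ℤₚ.∣-i∣≡∣i∣ (+ C))) (inR⁻ (v (+ b)) (app-range w (pt-R P)))
        x≤n : x ≤ n
        x≤n = ≤-trans (<⇒≤ x<C) C≤n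
      ...   | a , aR , eq with ℤₚ.<-cmp a (+ b)
      ...     | tri< a<b _ _  = inj₁ (D<x , x<C , a , aR , a<b , eq)
      ...     | tri≈ _ refl _ = ⊥-elim (<-irrefl (neg-injective (trans (sym eq) (pt-app P))) x<C)
      ...     | tri> _ _ (ℤ.+<+ {n = i} b<i) =
                  inj₂ λ _ _ → i , ss-entry⁺ (≤-<-trans z≤n b<i) (inR⁻ (+ i) aR) (≤-<-trans z≤n D<x) eq , b<i
    ... | inj₁ filled | _ = inj₁ λ i b<i i<d → filled i i<d b<i i<d
    ... | inj₂ _      | inj₁ used = inj₂ λ x D<x x<C → used x x<C D<x x<C
    ... | inj₂ (c , _ , (b<c , c<d , vd<vc) , _) | inj₂ (x , _ , (D<x , x<C , a , aR , a<b , eq) , _) =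
      ⊥-elim (vex a (+ b) (+ c) (+ d) aR (pt-R P) (inR⁺ (+ c) (≤-trans (<⇒≤ c<d) (inR⁻ (+ d) (pt-R Q)))) (pt-R Q)
        a<b (ℤ.+<+ b<c) (ℤ.+<+ c<d)
        ( subst₂ ℤ._<_ (sym (pt-app P)) (sym eq) (neg-mono x<C)
        , subst₂ ℤ._<_ (sym eq) (sym (pt-app Q)) (neg-mono D<x)
        , vd<vc ))

    good : Good ss
    good = record
      { negative  = λ e → let _ , _ , _ , c , eq = ss-entry⁻ e in suc c , s≤s z≤n , eq
      ; injective = λ P Q → ℤₚ.+-injective (app-injective w (pt-R P) (pt-R Q) (trans (pt-app P) (sym (pt-app Q))))
      ; pair      = good-pair
      }

    -- A descent among the positive values forms a 2143 pattern with its
    -- own mirror image.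
    increasing : ∀ {i j c d} → Entry 1 (oneLine w n) i (+ c) → Entry 1 (oneLine w n) j (+ d) → i < j → c < d
    increasing {i} {j} {c} {d} e e′ i<j with <-cmp c d
    ... | tri< c<d _ _ = c<d
    ... | tri≈ _ refl _ = ⊥-elim (<-irrefl (ℤₚ.+-injective (app-injective w (line-R e) (line-R e′)
                            (trans (oneLine-app w {n} e) (sym (oneLine-app w {n} e′))))) i<j)
    ... | tri> _ _ d<c = ⊥-elim (vex (neg j) (neg i) (+ i) (+ j)
        (inR-neg (+ j) (line-R e′)) (inR-neg (+ i) (line-R e)) (line-R e) (line-R e′)
        (neg-mono i<j) -i<i (ℤ.+<+ i<j)
        ( subst₂ ℤ._<_ (sym (trans (app-neg w (+ i)) (cong -_ vi))) (sym (trans (app-neg w (+ j)) (cong -_ vj))) (neg-mono d<c)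
        , subst₂ ℤ._<_ (sym (trans (app-neg w (+ j)) (cong -_ vj))) (sym vj) -d<d
        , subst₂ ℤ._<_ (sym vj) (sym vi) (ℤ.+<+ d<c) ))
      where
      vi = oneLine-app w {n} e
      vj = oneLine-app w {n} e′
      neg<pos : ∀ {x} → 0 < x → neg x ℤ.< + x
      neg<pos {suc x} _ = ℤ.-<+
      -i<i : neg i ℤ.< + i
      -i<i = neg<pos (proj₁ (line-bounds e))
      -d<d : neg d ℤ.< + d
      -d<d = neg<pos (subst (0 <_) (cong ∣_∣ vj) (proj₁ (app-abs-range w (proj₁ (line-bounds e′)) (proj₂ (line-bounds e′)))))

  avoiding⇒vexillary : Vexillary w
  avoiding⇒vexillary = τ , isTriple , n , ≤-refl , built
    where
    open Stage (stage (count ss) ss good refl)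
    open Uses uses
    unused : ℕ → List ℕ
    unused l = filter (λ c → ¬? (c ∈? used)) (rangeFrom 1 l)
    sub : ∀ {c} → c ∈ positives (oneLine w n) → c ∈ unused n
    sub {c} c∈ with ∈-positives⁻ 1 (oneLine w n) c∈
    ... | i , e with line-bounds e | oneLine-app w {n} e
    ...   | 0<i , i≤n | vi = ∈-filter⁺ (λ c → ¬? (c ∈? used)) (∈-rangeFrom⁺ n 0<c (s≤s c≤n)) c∉
      where
      0<c : 0 < c
      0<c = subst (0 <_) (cong ∣_∣ vi) (proj₁ (app-abs-range w 0<i i≤n))
      c≤n : c ≤ n
      c≤n = subst (_≤ n) (cong ∣_∣ vi) (proj₂ (app-abs-range w 0<i i≤n))
      c∉ : c ∉ used
      c∉ c∈used with sound c∈used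
      ... | j , P with app-abs-injective w 0<i i≤n (proj₁ (ss-entry⁻ P)) (proj₁ (proj₂ (ss-entry⁻ P)))
                         (trans (cong ∣_∣ vi) (sym (trans (cong ∣_∣ (pt-app P)) (ℤₚ.∣-i∣≡∣i∣ (+ c)))))
      ...   | refl = <-irrefl (sym (ℤₚ.+-injective (neg-fixed (+ c) (trans (sym vi) (pt-app P))))) 0<c
    sup : ∀ {c} → c ∈ unused n → c ∈ positives (oneLine w n)
    sup {c} c∈ with ∈-filter⁻ (λ c → ¬? (c ∈? used)) {xs = rangeFrom 1 n} c∈
    ... | c∈r , c∉ with ∈-rangeFrom⁻ n c∈r
    ...   | 0<c , s≤s c≤n with app-abs-surjective w 0<c c≤n
    ...     | i , 0<i , i≤n , eq with abs-cases (v (+ i)) (+ c) eq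
    ...       | inj₁ vi = ∈-positives⁺ (oneLine w n) (subst (Entry 1 _ i) vi (line-entry 0<i i≤n))
    ...       | inj₂ vi = ⊥-elim (c∉ (complete (ss-entry⁺ 0<i i≤n 0<c vi)))
    agree : positives (oneLine w n) ≡ unused n
    agree = sorted-extensional (positives-sorted 1 (oneLine w n) increasing) (filtered-sorted 1 n used) sub sup
    built : buildW n τ ≡ just (oneLine w n)
    built rewrite subst (λ l → blocks 0 τ (replicate l nothing) [] ≡ just (ss , used))
                        (trans (length-map negOnly (oneLine w n)) (length-oneLine w n)) builds
      | rangeFrom-++ 1 n (length used)
      | filter-++ (λ c → ¬? (c ∈? used)) (rangeFrom 1 n) (rangeFrom (suc n) (length used))
      | sym agree = fill-positives (oneLine w n) _

-- Corners and essential positions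

<⇒+1≤ : ∀ {x y} → x ℤ.< y → x ℤ.+ + 1 ℤ.≤ y
<⇒+1≤ {x} {y} x<y = subst (ℤ._≤ y) (ℤₚ.+-comm (+ 1) x) (ℤₚ.i<j⇒suc[i]≤j x<y)

+1≤⇒< : ∀ {x y} → x ℤ.+ + 1 ℤ.≤ y → x ℤ.< y
+1≤⇒< {x} {y} x+1≤y = ℤₚ.suc[i]≤j⇒i<j (subst (ℤ._≤ y) (ℤₚ.+-comm x (+ 1)) x+1≤y)

x<x+1 : ∀ x → x ℤ.< x ℤ.+ + 1
x<x+1 x = +1≤⇒< ℤₚ.≤-refl

x+1-1 : ∀ x → x ℤ.+ + 1 ℤ.- + 1 ≡ x
x+1-1 x = trans (ℤₚ.+-assoc x (+ 1) -[1+ 0 ]) (ℤₚ.+-identityʳ x)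

x-1+1 : ∀ x → x ℤ.- + 1 ℤ.+ + 1 ≡ x
x-1+1 x = trans (ℤₚ.+-assoc x -[1+ 0 ] (+ 1)) (ℤₚ.+-identityʳ x)

neg+1 : ∀ x → - (x ℤ.+ + 1) ℤ.+ + 1 ≡ - x
neg+1 x = trans (cong (ℤ._+ + 1) (ℤₚ.neg-distrib-+ x (+ 1))) (x-1+1 (- x))

-- A discrete intermediate value argument: on the way up from `x`, `P` persists until `Q` is met,
-- and `Q` is met no later than `y`, where `P` fails.
switch : ∀ {P Q : ℤ → Set} {x y} → (∀ z → x ℤ.≤ z → z ℤ.≤ y → P z ⊎ Q z) → x ℤ.≤ y → P x → ¬ P y →
         ∃ λ z → x ℤ.≤ z × z ℤ.< y × P z × Q (z ℤ.+ + 1)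
switch {P} {Q} {x} {y} f x≤y = walk ∣ y ℤ.- x ∣ x ℤₚ.≤-refl
    (trans (sym x+[y-x]) (cong (λ t → x ℤ.+ t) (sym (ℤₚ.0≤i⇒+∣i∣≡i (ℤₚ.i≤j⇒0≤j-i x≤y)))))
  where
  x+[y-x] : x ℤ.+ (y ℤ.- x) ≡ y
  x+[y-x] = trans (ℤₚ.+-comm x (y ℤ.- x)) (trans (ℤₚ.+-assoc y (- x) x)
              (trans (cong (λ t → y ℤ.+ t) (ℤₚ.+-inverseˡ x)) (ℤₚ.+-identityʳ y)))
  walk : ∀ m z → x ℤ.≤ z → y ≡ z ℤ.+ + m → P z → ¬ P y → ∃ λ z → x ℤ.≤ z × z ℤ.< y × P z × Q (z ℤ.+ + 1)
  walk zero z x≤z eq Pz ¬Py = ⊥-elim (¬Py (subst P (sym (trans eq (ℤₚ.+-identityʳ z))) Pz))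
  walk (suc m) z x≤z eq Pz ¬Py with f (z ℤ.+ + 1) x≤z+1 (subst (z ℤ.+ + 1 ℤ.≤_) (sym eq) (ℤₚ.+-monoʳ-≤ z (ℤ.+≤+ (s≤s z≤n))))
    where
    x≤z+1 : x ℤ.≤ z ℤ.+ + 1
    x≤z+1 = ℤₚ.≤-trans x≤z (ℤₚ.<⇒≤ (x<x+1 z))
  ... | inj₂ Qz+1 = z , x≤z , subst (z ℤ.<_) (sym eq) (+1≤⇒< (ℤₚ.+-monoʳ-≤ z (ℤ.+≤+ (s≤s z≤n)))) , Pz , Qz+1
  ... | inj₁ Pz+1 = walk m (z ℤ.+ + 1) (ℤₚ.≤-trans x≤z (ℤₚ.<⇒≤ (x<x+1 z))) (trans eq (sym (ℤₚ.+-assoc z (+ 1) (+ m)))) Pz+1 ¬Py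

lex-pairs : ∀ {R : A → A → Set} {S : B → B → Set} {xs ys} → AllPairs R xs → AllPairs S ys →
            AllPairs (λ a b → R (proj₁ a) (proj₁ b) ⊎ (proj₁ a ≡ proj₁ b × S (proj₂ a) (proj₂ b))) (cartesianProduct xs ys)
lex-pairs [] _ = []
lex-pairs {xs = x ∷ xs} {ys} (Rx ∷ Rxs) Sys =
  AllPairsₚ.++⁺ (AllPairsₚ.map⁺ (AllPairs.map (λ s → inj₂ (refl , s)) Sys)) (lex-pairs Rxs Sys)
    (Allₚ.map⁺ (All.tabulate λ _ → All.tabulate λ {b} b∈ → inj₁ (All.lookup Rx (proj₁ (∈-cartesianProduct⁻ xs ys b∈)))))

refine-pairs : ∀ {P : A → Set} {R S : A → A → Set} {xs} → (∀ {x y} → P x → P y → R x y → S x y) →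
               All P xs → AllPairs R xs → AllPairs S xs
refine-pairs f []         []         = []
refine-pairs f (px ∷ pxs) (rx ∷ rxs) = All.zipWith (λ (py , r) → f px py r) (pxs , rx) ∷ refine-pairs f pxs rxs

pairs-comparable : ∀ {R : A → A → Set} {xs x y} → (∀ {x} → R x x) → AllPairs R xs → x ∈ xs → y ∈ xs → R x y ⊎ R y x
pairs-comparable rfl (_ ∷ _)  (here refl) (here refl) = inj₁ rfl
pairs-comparable rfl (rx ∷ _) (here refl) (there y∈)  = inj₁ (All.lookup rx y∈)
pairs-comparable rfl (rx ∷ _) (there x∈)  (here refl) = inj₂ (All.lookup rx x∈)
pairs-comparable rfl (_ ∷ r)  (there x∈)  (there y∈)  = pairs-comparable rfl r x∈ y∈

inR-between : ∀ {n x y z} → InR n x → InR n y → x ℤ.≤ z → z ℤ.≤ y → InR n z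
inR-between (n≤x , _) (_ , y≤n) x≤z z≤y = ℤₚ.≤-trans n≤x x≤z , ℤₚ.≤-trans z≤y y≤n

inR? : ∀ n x → Dec (InR n x)
inR? n x = (- (+ n) ℤ.≤? x) ×-dec (x ℤ.≤? + n)

module _ {n : ℕ} (w : SignedPerm n) where

  private
    v : ℤ → ℤ
    v = app w

    0R : InR n (+ 0)
    0R = inR⁺ (+ 0) z≤n

  -- The SE corners of the full diagram D(ι(w)).
  record Corner (r c : ℤ) : Set where
    field
      cR    : InR n c
      c+1R  : InR n (c ℤ.+ + 1)
      above : r ℤ.< v c
      below : v (c ℤ.+ + 1) ℤ.≤ r
      right : ∃ λ j → InR n j × v j ≡ r × c ℤ.< j
      left  : ∃ λ j → InR n j × v j ≡ r ℤ.+ + 1 × j ℤ.≤ c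

  -- Two applications of `switch`. The first finds a column `c` after which the value drops below
  -- `v a`; the second climbs through the rows towards `v a` until the entry of the next row is no
  -- longer to the right of `c`.
  descent-corner : ∀ {a b} → InR n a → InR n b → a ℤ.< b → v b ℤ.< v a →
                   ∃₂ λ r c → Corner r c × a ℤ.≤ c × c ℤ.< b × v b ℤ.≤ r × r ℤ.< v a
  descent-corner {a} {b} aR bR a<b vb<va
    with switch {P = λ z → v a ℤ.≤ v z} {λ z → v z ℤ.< v a} {a} {b}
           (λ z _ _ → [ inj₁ , (λ va≰ → inj₂ (ℤₚ.≰⇒> va≰)) ]′ (toSum (v a ℤ.≤? v z)))
           (ℤₚ.<⇒≤ a<b) ℤₚ.≤-refl (ℤₚ.<⇒≱ vb<va)
  ... | c , a≤c , c<b , va≤vc , vc+1<va = found (ℤₚ.≤-total (v b) (v (c ℤ.+ + 1)))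
    where
    cR : InR n c
    cR = inR-between aR bR a≤c (ℤₚ.<⇒≤ c<b)
    c+1R : InR n (c ℤ.+ + 1)
    c+1R = inR-between aR bR (ℤₚ.≤-trans a≤c (ℤₚ.<⇒≤ (x<x+1 c))) (<⇒+1≤ c<b)
    side : ∀ z → InR n z → (∃ λ j → InR n j × v j ≡ z × c ℤ.< j) ⊎ (∃ λ j → InR n j × v j ≡ z × j ℤ.≤ c)
    side z zR with app-surjective w zR
    ... | j , jR , vj with j ℤ.≤? c
    ...   | yes j≤c = inj₂ (j , jR , vj , j≤c)
    ...   | no  j≰c = inj₁ (j , jR , vj , ℤₚ.≰⇒> j≰c)
    from : ∀ {k} → InR n k → c ℤ.< k → v k ℤ.< v a → v b ℤ.≤ v k → v (c ℤ.+ + 1) ℤ.≤ v k →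
           ∃₂ λ r c → Corner r c × a ℤ.≤ c × c ℤ.< b × v b ℤ.≤ r × r ℤ.< v a
    from {k} kR c<k vk<va vb≤vk vc+1≤vk
      with switch (λ z s≤z z≤va → side z (inR-between (app-range w kR) (app-range w aR) s≤z z≤va))
             (ℤₚ.<⇒≤ vk<va) (k , kR , refl , c<k)
             (λ { (j , jR , vj , c<j) → ℤₚ.<-irrefl (app-injective w aR jR (sym vj)) (ℤₚ.≤-<-trans a≤c c<j) })
    ... | r , vk≤r , r<va , right , left = r , c , record
      { cR = cR ; c+1R = c+1R ; above = ℤₚ.<-≤-trans r<va va≤vc ; below = ℤₚ.≤-trans vc+1≤vk vk≤r
      ; right = right ; left = left } , a≤c , c<b , ℤₚ.≤-trans vb≤vk vk≤r , r<va
    -- The climb starts at the larger of `v b` and `v (c + 1)`, so that both are lower bounds for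
    -- `r`.
    found : v b ℤ.≤ v (c ℤ.+ + 1) ⊎ v (c ℤ.+ + 1) ℤ.≤ v b →
            ∃₂ λ r c → Corner r c × a ℤ.≤ c × c ℤ.< b × v b ℤ.≤ r × r ℤ.< v a
    found (inj₁ vb≤) = from c+1R (x<x+1 c) vc+1<va vb≤ ℤₚ.≤-refl
    found (inj₂ ≤vb) = from bR c<b vb<va ℤₚ.≤-refl ≤vb

  -- Row `r₁ + 1` has its entry in column `c₁` or to its left, and row `r₂` has its entry to the
  -- right of `c₂`. With the columns `c₁ + 1` and `c₂` between them, these form a 2143 pattern if
  -- the first corner is strictly NW of the second.
  corners-antichain : VexillaryPerm n v → ∀ {r₁ c₁ r₂ c₂} → Corner r₁ c₁ → Corner r₂ c₂ → c₁ ℤ.< c₂ → ¬ r₁ ℤ.< r₂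
  corners-antichain vex {r₁} {c₁} {r₂} {c₂} K₁ K₂ c₁<c₂ r₁<r₂ with Corner.left K₁ | Corner.right K₂
  ... | a , aR , va , a≤c₁ | d , dR , vd , c₂<d =
    vex a (c₁ ℤ.+ + 1) c₂ d aR (c+1R K₁) (cR K₂) dR (ℤₚ.≤-<-trans a≤c₁ (x<x+1 c₁))
      (ℤₚ.≤∧≢⇒< (<⇒+1≤ c₁<c₂)
        (λ eq → ℤₚ.<-asym r₁<r₂ (ℤₚ.<-≤-trans (above K₂) (subst (λ z → v z ℤ.≤ r₁) eq (below K₁)))))
      c₂<d
      ( subst (v (c₁ ℤ.+ + 1) ℤ.<_) (sym va) (ℤₚ.≤-<-trans (below K₁) (x<x+1 r₁))
      , ℤₚ.≤∧≢⇒< (subst₂ ℤ._≤_ (sym va) (sym vd) (<⇒+1≤ r₁<r₂))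
          (λ eq → ℤₚ.<-irrefl (app-injective w aR dR eq) (ℤₚ.≤-<-trans a≤c₁ (ℤₚ.<-trans c₁<c₂ c₂<d)))
      , subst (ℤ._< v c₂) (sym vd) (above K₂) )
    where open Corner

  -- Under x ↦ -x, `above` and `below` change places, and so do `left` and `right`. Strict and weak
  -- inequalities are exchanged, whence the shift by one.
  reflect : ∀ {r c} → Corner r c → Corner (- (r ℤ.+ + 1)) (- (c ℤ.+ + 1))
  reflect {r} {c} K = record
    { cR    = inR-neg _ c+1R
    ; c+1R  = subst (InR n) (sym (neg+1 c)) (inR-neg _ cR)
    ; above = subst (- (r ℤ.+ + 1) ℤ.<_) (sym (app-neg w (c ℤ.+ + 1))) (ℤₚ.neg-mono-< (ℤₚ.≤-<-trans below (x<x+1 r)))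
    ; below = subst (ℤ._≤ - (r ℤ.+ + 1)) (trans (sym (app-neg w c)) (cong v (sym (neg+1 c)))) (ℤₚ.neg-mono-≤ (<⇒+1≤ above))
    ; right = let j , jR , vj , j≤c = left in
              - j , inR-neg j jR , trans (app-neg w j) (cong -_ vj) , ℤₚ.neg-mono-< (ℤₚ.≤-<-trans j≤c (x<x+1 c))
    ; left  = let j , jR , vj , c<j = right in
              - j , inR-neg j jR , trans (app-neg w j) (trans (cong -_ vj) (sym (neg+1 r))) , ℤₚ.neg-mono-≤ (<⇒+1≤ c<j)
    }
    where open Corner K

  corner⇒SECorner : ∀ {r c} → Corner r c → c ℤ.≤ -[1+ 0 ] → SECorner w r c
  corner⇒SECorner {r} {c} K c≤-1 = ((rR , cR , above , right) , c≤-1) , ¬down , ¬across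
    where
    open Corner K
    rR : InR n r
    rR = let j , jR , vj , _ = right in subst (InR n) vj (app-range w jR)
    ¬down : ¬ InDtilde w (r ℤ.+ + 1) c
    ¬down ((_ , _ , _ , j , jR , vj , c<j) , _) with left
    ... | j′ , j′R , vj′ , j′≤c = ℤₚ.<-irrefl (app-injective w j′R jR (trans vj′ (sym vj))) (ℤₚ.≤-<-trans j′≤c c<j)
    ¬across : ¬ InDtilde w r (c ℤ.+ + 1)
    ¬across ((_ , _ , r<v , _) , _) = ℤₚ.<-irrefl refl (ℤₚ.<-≤-trans r<v below)

  -- In column -1 the diagram is cut off, which creates corners in
  -- negative rows that D(ι(w)) does not have.
  SECorner⇒corner : ∀ {r c} → SECorner w r c → c ℤ.< -[1+ 0 ] ⊎ + 0 ℤ.≤ r → Corner r c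
  SECorner⇒corner {r} {c} (((rR , cR , r<vc , right@(j , jR , vj , c<j)) , c≤-1) , ¬down , ¬across) genuine = record
    { cR = cR ; c+1R = c+1R ; above = r<vc ; below = below genuine ; right = right ; left = left }
    where
    c+1R : InR n (c ℤ.+ + 1)
    c+1R = inR-between cR jR (ℤₚ.<⇒≤ (x<x+1 c)) (<⇒+1≤ c<j)
    left : ∃ λ j → InR n j × v j ≡ r ℤ.+ + 1 × j ℤ.≤ c
    left with app-surjective w (inR-between rR (app-range w cR) (ℤₚ.<⇒≤ (x<x+1 r)) (<⇒+1≤ r<vc))
    ... | j′ , j′R , vj′ with j′ ℤ.≤? c
    ...   | yes j′≤c = j′ , j′R , vj′ , j′≤c
    ...   | no  j′≰c = ⊥-elim (¬down ((r+1R , cR , r+1<vc , j′ , j′R , vj′ , ℤₚ.≰⇒> j′≰c) , c≤-1))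
      where
      r+1R : InR n (r ℤ.+ + 1)
      r+1R = inR-between rR (app-range w cR) (ℤₚ.<⇒≤ (x<x+1 r)) (<⇒+1≤ r<vc)
      r+1<vc : r ℤ.+ + 1 ℤ.< v c
      r+1<vc = ℤₚ.≤∧≢⇒< (<⇒+1≤ r<vc) λ eq →
        ℤₚ.<-irrefl (app-injective w cR j′R (trans (sym eq) (sym vj′))) (ℤₚ.≰⇒> j′≰c)
    inside : c ℤ.< -[1+ 0 ] → v (c ℤ.+ + 1) ℤ.≤ r
    inside c<-1 = ℤₚ.≮⇒≥ λ r<v → ¬across ((rR , c+1R , r<v , j , jR , vj ,
      ℤₚ.≤∧≢⇒< (<⇒+1≤ c<j) (λ eq → ℤₚ.<-irrefl (trans (sym vj) (cong v (sym eq))) r<v)) , <⇒+1≤ c<-1)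
    below : c ℤ.< -[1+ 0 ] ⊎ + 0 ℤ.≤ r → v (c ℤ.+ + 1) ℤ.≤ r
    below (inj₁ c<-1) = inside c<-1
    below (inj₂ 0≤r) with ℤₚ.<-cmp c -[1+ 0 ]
    ... | tri< c<-1 _ _ = inside c<-1
    -- For `c = -1` the next column is 0, whose value is 0, so `below` is the hypothesis on `r`.
    ... | tri≈ _ refl _ = 0≤r
    ... | tri> _ _ c>-1 = ⊥-elim (ℤₚ.<-irrefl refl (ℤₚ.<-≤-trans c>-1 c≤-1))

  -- Decidability and listing of the essential positions

  private
    inDtilde? : ∀ a b → Dec (InDtilde w a b)
    inDtilde? a b with inR? n a
    ... | no ¬aR = no λ { ((aR , _) , _) → ¬aR aR }
    ... | yes aR with app-surjective w aR
    ...   | j , jR , vj = map′ (λ { (bR , a<v , b<j , b≤-1) → (aR , bR , a<v , j , jR , vj , b<j) , b≤-1 })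
                               (λ { ((_ , bR , a<v , j′ , j′R , vj′ , b<j′) , b≤-1) → bR , a<v ,
                                    subst (b ℤ.<_) (app-injective w j′R jR (trans vj′ (sym vj))) b<j′ , b≤-1 })
                               (inR? n b ×-dec (a ℤ.<? v b) ×-dec (b ℤ.<? j) ×-dec (b ℤ.≤? -[1+ 0 ]))

    SECorner? : ∀ a b → Dec (SECorner w a b)
    SECorner? a b = inDtilde? a b ×-dec ¬? (inDtilde? (a ℤ.+ + 1) b) ×-dec ¬? (inDtilde? a (b ℤ.+ + 1))

    inEss? : ∀ k p q → Dec (InEss w k p q)
    inEss? k p q = SECorner? _ _ ×-dec (k ℕ.≟ rank w p q) ×-dec ¬? ((p ℕ.≟ 1) ×-dec (q ℤ.<? + 0)) ×-dec
      ¬? ((1 ℕ.<? p) ×-dec (+ 0 ℤ.<? q) ×-dec SECorner? _ _ ×-dec (k ℕ.≟ rank w p q) ×-dec (_ ℤ.≟ _))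

  essPos? : ∀ x → Dec (EssPos w x)
  essPos? (p , q) = map′ (rank w p q ,_) (λ { (_ , ess@(_ , refl , _)) → ess }) (inEss? (rank w p q) p q)

  OrderedEssPos : Set
  OrderedEssPos = Σ (List (ℕ × ℤ)) λ L →
    Unique L ×
    (∀ x → (x ∈ L) ⇔ EssPos w x) ×
    Linked (λ x y → (proj₁ y ≤ proj₁ x) × (proj₂ y ℤ.≤ proj₂ x)) L ×
    All (λ x → (0 < proj₁ x) × (+ 0 ℤ.< proj₂ x)) L

  module _ (vex : VexillaryPerm n v) where

    -- A corner in a negative row and column lies strictly NW of its reflection.
    essPos-corner : ∀ {p q} → EssPos w (p , q) → 0 < p × + 0 ℤ.< q × Corner (q ℤ.- + 1) (neg p)
    essPos-corner {zero} (_ , ((_ , ()) , _) , _)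
    essPos-corner {suc zero} {q} (_ , se@(((_ , cR , r<v , _) , _) , ¬down , _) , _ , ¬cut , _) with ℤₚ.<-cmp q (+ 0)
    ... | tri< q<0 _ _  = ⊥-elim (¬cut (refl , q<0))
    -- For q = 0 the box below the corner, in row 0 and column -1, is in the diagram as well: v(-1)
    -- > -1 and v(-1) ≠ 0, and row 0 has its entry in column 0.
    ... | tri≈ _ refl _ = ⊥-elim (¬down ((0R , cR , 0<v , + 0 , 0R , refl , ℤ.-<+) , ℤₚ.≤-refl))
      where
      0<v : + 0 ℤ.< v -[1+ 0 ]
      0<v = ℤₚ.≤∧≢⇒< (<⇒+1≤ r<v) λ eq → -1≢0 (app-zero w cR (sym eq))
        where
        -1≢0 : -[1+ 0 ] ≢ + 0
        -1≢0 ()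
    ... | tri> _ _ 0<q  = s≤s z≤n , 0<q , SECorner⇒corner se (inj₂ (0≤q-1 0<q))
      where
      0≤q-1 : ∀ {q} → + 0 ℤ.< q → + 0 ℤ.≤ q ℤ.- + 1
      0≤q-1 {+ suc q} _ = ℤ.+≤+ z≤n
      0≤q-1 {+ zero} (ℤ.+<+ ())
    essPos-corner {suc (suc p)} {q} (_ , se , _) with + 0 ℤ.<? q
    ... | yes 0<q = s≤s z≤n , 0<q , SECorner⇒corner se (inj₁ (ℤ.-<- (s≤s z≤n)))
    ... | no  0≮q = ⊥-elim (corners-antichain vex K (reflect K) ℤ.-<+ r<r′)
      where
      K : Corner (q ℤ.- + 1) (neg (suc (suc p)))
      K = SECorner⇒corner se (inj₁ (ℤ.-<- (s≤s z≤n)))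
      r<r′ : q ℤ.- + 1 ℤ.< - (q ℤ.- + 1 ℤ.+ + 1)
      r<r′ = subst (λ z → q ℤ.- + 1 ℤ.< - z) (sym (x-1+1 q))
        (ℤₚ.<-≤-trans (subst (q ℤ.- + 1 ℤ.<_) (x-1+1 q) (x<x+1 (q ℤ.- + 1)))
          (ℤₚ.≤-trans (ℤₚ.≮⇒≥ 0≮q) (ℤₚ.neg-mono-≤ (ℤₚ.≮⇒≥ 0≮q))))

    private
      -- The column -p and the row q - 1 of a corner lie between -n and n, so p ≤ n and q ≤ n + 1;
      -- `q` is positive by `essPos-corner`. The enumeration decreases lexicographically, which
      -- `chain` turns into the required order.
      candidates : List (ℕ × ℤ)
      candidates = cartesianProduct (downFrom (suc n)) (map +_ (downFrom (suc (suc n))))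

      Lex : ℕ × ℤ → ℕ × ℤ → Set
      Lex x y = proj₁ y < proj₁ x ⊎ (proj₁ x ≡ proj₁ y × proj₂ y ℤ.< proj₂ x)

      decreasing : ∀ m → AllPairs (λ i j → j < i) (downFrom m)
      decreasing m = AllPairsₚ.applyDownFrom⁺₁ (λ i → i) m λ j<i _ → j<i

      lex : AllPairs Lex (filter essPos? candidates)
      lex = AllPairsₚ.filter⁺ essPos? (lex-pairs (decreasing (suc n)) (AllPairsₚ.map⁺ (AllPairs.map ℤ.+<+ (decreasing (suc (suc n))))))

      candidate : ∀ {x} → EssPos w x → x ∈ candidates
      candidate {p , -[1+ _ ]} ess with () ← proj₁ (proj₂ (essPos-corner ess))
      candidate {p , + q} (_ , (((qR , pR , _) , _) , _) , _) = ∈-cartesianProduct⁺ (∈-downFrom⁺ (s≤s p≤n)) (∈-map⁺ +_ (∈-downFrom⁺ (s≤s q≤)))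
        where
        p≤n : p ≤ n
        p≤n = subst (_≤ n) (ℤₚ.∣-i∣≡∣i∣ (+ p)) (inR⁻ (neg p) pR)
        q≤ : q ≤ suc n
        q≤ = ℤₚ.drop‿+≤+ (subst₂ ℤ._≤_ (x-1+1 (+ q)) (cong +_ (ℕₚ.+-comm n 1)) (ℤₚ.+-monoˡ-≤ (+ 1) (proj₂ qR)))

      -- A larger `p` means a column further left. As no corner is strictly NW of another, the
      -- corner further left is in a row at least as large.
      chain : ∀ {x y} → EssPos w x → EssPos w y → Lex x y → (proj₁ y ≤ proj₁ x) × (proj₂ y ℤ.≤ proj₂ x)
      chain _ _ (inj₂ (refl , q′<q)) = ≤-refl , ℤₚ.<⇒≤ q′<q
      chain ex ey (inj₁ p′<p) with essPos-corner ex | essPos-corner ey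
      ... | _ , _ , K | _ , _ , K′ = <⇒≤ p′<p , ℤₚ.≮⇒≥ λ q<q′ →
        corners-antichain vex K K′ (neg-mono p′<p) (ℤₚ.+-monoˡ-< -[1+ 0 ] q<q′)

    avoiding⇒ordered : OrderedEssPos
    avoiding⇒ordered = filter essPos? candidates
      , AllPairs.map (λ { (inj₁ p<p) refl → <-irrefl refl p<p ; (inj₂ (_ , q<q)) refl → ℤₚ.<-irrefl refl q<q }) lex
      , (λ x → mk⇔ (λ x∈ → proj₂ (∈-filter⁻ essPos? {xs = candidates} x∈)) (λ ess → ∈-filter⁺ essPos? (candidate ess) ess))
      , AllPairs⇒Linked (refine-pairs chain (Allₚ.all-filter essPos? candidates) lex)
      , All.map (λ ess → let 0<p , 0<q , _ = essPos-corner ess in 0<p , 0<q) (Allₚ.all-filter essPos? candidates)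

  -- The descents from `a` to `b` and from `c` to `d` contain corners. The first has column less
  -- than `b` and row less than `v a`, the second has column at least `c` and row at least `v d`, so
  -- the first is strictly NW of the second.
  ordered⇒avoiding : OrderedEssPos → VexillaryPerm n v
  ordered⇒avoiding (L , _ , ess , linked , positive) a b c d aR bR cR dR a<b b<c c<d (B<A , A<D , D<C)
    with descent-corner aR bR a<b B<A | descent-corner cR dR c<d D<C
  ... | r₁ , c₁ , K₁ , _ , c₁<b , _ , r₁<A | r₂ , c₂ , K₂ , c≤c₂ , _ , D≤r₂ , _ =
    antichain K₁ K₂ (ℤₚ.<-trans c₁<b (ℤₚ.<-≤-trans b<c c≤c₂)) (ℤₚ.<-trans r₁<A (ℤₚ.<-≤-trans A<D D≤r₂))
    where
    q-positive : ∀ {x} → EssPos w x → + 0 ℤ.< proj₂ x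
    q-positive {x} e = proj₂ (All.lookup positive (Equivalence.from (ess x) e))

    -- In the exceptional case of the definition of the essential set the
    -- second corner is itself essential, in a negative row.
    essential : ∀ {r c} → Corner r c → c ℤ.≤ -[1+ 0 ] → ∃ λ p → c ≡ neg p × EssPos w (p , r ℤ.+ + 1)
    essential {r} { -[1+ p ]} K c≤-1 = suc p , refl , rank w (suc p) (r ℤ.+ + 1)
      , subst (λ z → SECorner w z -[1+ p ]) (sym (x+1-1 r)) (corner⇒SECorner K c≤-1) , refl , ¬cut , ¬exception
      where
      q = r ℤ.+ + 1
      ¬cut : ¬ (suc p ≡ 1 × q ℤ.< + 0)
      ¬cut (refl , q<0) = ℤₚ.<-asym q<0 (ℤₚ.≤-<-trans (Corner.below K) (x<x+1 r))
      ¬exception : ¬ (1 < suc p × + 0 ℤ.< q × SECorner w (- q) -[1+ p ] × rank w (suc p) q ≡ rank w (suc p) q ×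
                      + rank w (suc p) q ≡ (+ rank w (suc p) (- q ℤ.+ + 1)) ℤ.- q ℤ.+ + 1)
      ¬exception (1<p , 0<q , se , _) = ℤₚ.<-irrefl refl (ℤₚ.<-≤-trans (q-positive mirror) q′≤0)
        where
        q′≤0 : - q ℤ.+ + 1 ℤ.≤ + 0
        q′≤0 = <⇒+1≤ (ℤₚ.neg-mono-< 0<q)
        mirror : EssPos w (suc p , - q ℤ.+ + 1)
        mirror = rank w (suc p) (- q ℤ.+ + 1) , subst (λ z → SECorner w z -[1+ p ]) (sym (x+1-1 (- q))) se , refl
          , (λ { (p≡1 , _) → <-irrefl (sym p≡1) 1<p })
          , (λ { (_ , 0<q′ , _) → ℤₚ.<-irrefl refl (ℤₚ.<-≤-trans 0<q′ q′≤0) })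

    row≥0 : ∀ {r c} → Corner r c → c ℤ.≤ -[1+ 0 ] → + 0 ℤ.≤ r
    row≥0 {r} K c≤-1 = let _ , _ , e = essential K c≤-1 in
      ℤₚ.≮⇒≥ λ r<0 → ℤₚ.<-irrefl refl (ℤₚ.<-≤-trans (q-positive e) (<⇒+1≤ r<0))

    -- The two essential positions are comparable. Since c₁ < c₂ means p₂ < p₁, the first one
    -- dominates, and q₂ ≤ q₁ says r₂ ≤ r₁.
    antichain-left : ∀ {r₁ c₁ r₂ c₂} → Corner r₁ c₁ → Corner r₂ c₂ → c₂ ℤ.≤ -[1+ 0 ] → c₁ ℤ.< c₂ → ¬ r₁ ℤ.< r₂
    antichain-left {r₁} {c₁} {r₂} {c₂} K₁ K₂ c₂≤-1 c₁<c₂ r₁<r₂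
      with essential K₁ (ℤₚ.≤-trans (ℤₚ.<⇒≤ c₁<c₂) c₂≤-1) | essential K₂ c₂≤-1
    ... | p₁ , refl , e₁ | p₂ , refl , e₂
      with pairs-comparable (≤-refl , ℤₚ.≤-refl) (Linked⇒AllPairs transitive linked)
             (Equivalence.from (ess _) e₁) (Equivalence.from (ess _) e₂)
      where
      transitive : ∀ {x y z : ℕ × ℤ} → (proj₁ y ≤ proj₁ x) × (proj₂ y ℤ.≤ proj₂ x) →
                   (proj₁ z ≤ proj₁ y) × (proj₂ z ℤ.≤ proj₂ y) → (proj₁ z ≤ proj₁ x) × (proj₂ z ℤ.≤ proj₂ x)
      transitive (p , q) (p′ , q′) = ≤-trans p′ p , ℤₚ.≤-trans q′ q
    ...   | inj₁ (_ , q₂≤q₁) = ℤₚ.<-irrefl refl (ℤₚ.<-≤-trans (ℤₚ.+-monoˡ-< (+ 1) r₁<r₂) q₂≤q₁)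
    ...   | inj₂ (p₁≤p₂ , _) = <-irrefl refl (<-≤-trans (neg-cancel c₁<c₂) p₁≤p₂)

    nonnegative : ∀ {x} → ¬ x ℤ.≤ -[1+ 0 ] → - (x ℤ.+ + 1) ℤ.≤ -[1+ 0 ]
    nonnegative x≰-1 = ℤₚ.neg-mono-≤ (ℤₚ.+-monoˡ-≤ (+ 1) (<⇒+1≤ (ℤₚ.≰⇒> x≰-1)))

    -- Two corners in columns ≥ 0 are reflected, which also exchanges their order. A corner in a
    -- column ≤ -1 has row ≥ 0 and, by reflection, one in a column ≥ 0 has a negative row, so r₁ <
    -- r₂ fails in the mixed case.
    antichain : ∀ {r₁ c₁ r₂ c₂} → Corner r₁ c₁ → Corner r₂ c₂ → c₁ ℤ.< c₂ → ¬ r₁ ℤ.< r₂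
    antichain {r₁} {c₁} {r₂} {c₂} K₁ K₂ c₁<c₂ r₁<r₂ with c₁ ℤ.≤? -[1+ 0 ] | c₂ ℤ.≤? -[1+ 0 ]
    ... | _         | yes c₂≤-1 = antichain-left K₁ K₂ c₂≤-1 c₁<c₂ r₁<r₂
    ... | no c₁≰-1  | no _      = antichain-left (reflect K₂) (reflect K₁) (nonnegative c₁≰-1)
                                    (ℤₚ.neg-mono-< (ℤₚ.+-monoˡ-< (+ 1) c₁<c₂)) (ℤₚ.neg-mono-< (ℤₚ.+-monoˡ-< (+ 1) r₁<r₂))
    ... | yes c₁≤-1 | no c₂≰-1  = ℤₚ.<-irrefl refl (ℤₚ.≤-<-trans (row≥0 K₁ c₁≤-1) (ℤₚ.<-trans r₁<r₂ (+1≤⇒< r₂+1≤0)))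
      where
      r₂+1≤0 : r₂ ℤ.+ + 1 ℤ.≤ + 0
      r₂+1≤0 = ℤₚ.neg-cancel-≤ {+ 0} {r₂ ℤ.+ + 1} (row≥0 (reflect K₂) (nonnegative c₂≰-1))

theorem2p5 : (n : ℕ) (w : SignedPerm n) →
    (Vexillary w ⇔
    (Σ (List (ℕ × ℤ)) λ L →
    Unique L ×
    (∀ x → (x ∈ L) ⇔ EssPos w x) ×
    Linked (λ x y → (proj₁ y ℕ.≤ proj₁ x) ×
    (proj₂ y ℤ.≤ proj₂ x)) L ×
    All (λ x → (0 ℕ.< proj₁ x) × (ℤ.+ 0 ℤ.< proj₂ x)) L))
    × (Vexillary w ⇔ VexillaryPerm n (ι w))
theorem2p5 n w =
  mk⇔ (λ vex → avoiding⇒ordered w (vexillary⇒avoiding w vex)) (λ ord → avoiding⇒vexillary w (ordered⇒avoiding w ord)) ,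
  mk⇔ (vexillary⇒avoiding w) (avoiding⇒vexillary w)
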